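{- There exists a polynomial-time algorithm which, given a permutation graph $G$ and integers $b$ and $w$, decides whether $G$ has a black-and-white coloring with $b$ black vertices and $w$ white vertices, i.e., whether there exist disjoint sets $B, W \subseteq V(G)$ with $|B| = b$ and $|W| = w$ such that no vertex of $B$ is adjacent in $G$ to any vertex of $W$.
   Context: Graphs are finite, simple and undirected. A black-and-white coloring of a graph $G=(V,E)$ with $b$ black and $w$ white vertices colors $b$ vertices black and $w$ other vertices white (the remaining vertices stay uncolored) such that no black vertex is adjacent to any white vertex. Permutation diagram and permutation graph: consider two horizontal lines $L_1$ and $L_2$, one above the other. Label $n$ distinct points on $L_1$ and $n$ distinct points on $L_2$, in each case with the labels $\{1,\dots,n\}$ (in arbitrary order, each label used once on each line). For each $k \in \{1,\dots,n\}$ connect the point with label $k$ on $L_1$ to the point with label $k$ on $L_2$ by a straight line segment. This is a permutation diagram. The corresponding permutation graph with vertex set $\{1,\dots,n\}$ is the intersection graph of the line segments: two distinct vertices are adjacent if and only if their line segments intersect. A graph is a permutation graph if it is (isomorphic to) the graph of some permutation diagram. Polynomial time means time polynomial in the size of the input. -}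

module Defs where

open import Data.Bool.Base using (Bool; true; false; T)
open import Data.Fin.Base using (Fin)
open import Data.Fin.Permutation using (Permutation′; _⟨$⟩ʳ_)
open import Data.Fin.Subset using (Subset; _∈_; _∩_; Empty; ∣_∣)
open import Data.Integer.Base as ℤ using (ℤ; +_; -[1+_])
open import Data.List.Base using (List; []; _∷_; tabulate)
open import Data.Nat.Base using (ℕ; zero; suc; _+_; _*_; _^_; _≤_; _≡ᵇ_)
open import Data.Nat.Binary.Base as ℕᵇ using (ℕᵇ; 2[1+_]; 1+[2_])
open import Data.Product.Base using (_×_; _,_; ∃-syntax; Σ-syntax)
open import Data.Rational.Base as ℚ using (ℚ; 0ℚ; 1ℚ)
open import Function.Bundles using (_⇔_)
open import Function.Definitions using (Injective)
open import Relation.Binary.PropositionalEquality.Core using (_≡_; _≢_)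
open import Relation.Nullary.Negation.Core using (¬_)

------------------------------------------------------------------------
-- Graphs and colorings

record Graph (n : ℕ) : Set where
  field
    adj     : Fin n → Fin n → Bool
    symm    : ∀ u v → adj u v ≡ adj v u
    irrefl  : ∀ v → adj v v ≡ false

  Adj : Fin n → Fin n → Set
  Adj u v = T (adj u v)

HasBlackAndWhiteColoring : ∀ {n} → Graph n → ℤ → ℤ → Set
HasBlackAndWhiteColoring {n} G b w =
  ∃[ B ] ∃[ W ]
    Empty (B ∩ W)
    × + ∣ B ∣ ≡ b
    × + ∣ W ∣ ≡ w
    × (∀ (u v : Fin n) → u ∈ B → v ∈ W → ¬ Graph.Adj G u v)

------------------------------------------------------------------------
-- Permutation diagrams

-- L₁ is the line y = 1 and L₂ the line y = 0; the label k sits at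
-- (top k , 1) and at (bottom k , 0).  Whether two segments meet depends
-- only on the left-to-right order of the points on each line, so
-- rational coordinates give the same graphs as real ones.  The common
-- point of two crossing segments with rational end points is rational.
record PermutationDiagram (n : ℕ) : Set where
  field
    top             : Fin n → ℚ
    bottom          : Fin n → ℚ
    top-distinct    : Injective _≡_ _≡_ top
    bottom-distinct : Injective _≡_ _≡_ bottom

  OnSegment : Fin n → ℚ → ℚ → Set
  OnSegment k x y =
    0ℚ ℚ.≤ y × y ℚ.≤ 1ℚ
    × x ≡ y ℚ.* top k ℚ.+ (1ℚ ℚ.- y) ℚ.* bottom k

  SegmentsIntersect : Fin n → Fin n → Set
  SegmentsIntersect k l = ∃[ x ] ∃[ y ] OnSegment k x y × OnSegment l x y

  DiagramAdj : Fin n → Fin n → Set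
  DiagramAdj k l = k ≢ l × SegmentsIntersect k l

IsPermutationGraph : ∀ {n} → Graph n → Set
IsPermutationGraph {n} G =
  Σ[ D ∈ PermutationDiagram n ] Σ[ σ ∈ Permutation′ n ]
    (∀ u v → Graph.Adj G u v
               ⇔ PermutationDiagram.DiagramAdj D (σ ⟨$⟩ʳ u) (σ ⟨$⟩ʳ v))

------------------------------------------------------------------------
-- The machine model: Jones's WHILE language over binary trees
-- (N. D. Jones, Computability and Complexity from a Programming
-- Perspective, 1997) with a conditional added, under his time measure.
-- The only atom is nil.
-- Every operation that is charged one unit takes constant time on trees
-- shared as pointers, and the class of problems decidable in polynomial
-- time is the same as for Turing machines.

data Tree : Set where
  nil  : Tree
  cons : Tree → Tree → Tree

size : Tree → ℕ
size nil        = 1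
size (cons l r) = suc (size l + size r)

-- As a truth value, nil is false and every other tree is true.
truth : Tree → Bool
truth nil        = false
truth (cons _ _) = true

head : Tree → Tree
head nil        = nil
head (cons l _) = l

tail : Tree → Tree
tail nil        = nil
tail (cons _ r) = r

Var : Set
Var = ℕ

data Expr : Set where
  var  : Var → Expr
  nil  : Expr
  cons : Expr → Expr → Expr
  hd   : Expr → Expr
  tl   : Expr → Expr

infix  6 _≔_
infixr 5 _⨾_
infix  6 if_then_else_ while_loop_

data Cmd : Set where
  _≔_           : Var → Expr → Cmd
  _⨾_           : Cmd → Cmd → Cmd
  if_then_else_ : Expr → Cmd → Cmd → Cmd
  while_loop_   : Expr → Cmd → Cmd

Store : Set
Store = Var → Tree

_[_↦_] : Store → Var → Tree → Store
(s [ x ↦ d ]) y with x ≡ᵇ y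
... | true  = d
... | false = s y

eval : Expr → Store → Tree
eval (var x)    s = s x
eval nil        s = nil
eval (cons e f) s = cons (eval e s) (eval f s)
eval (hd e)     s = head (eval e s)
eval (tl e)     s = tail (eval e s)

cost : Expr → ℕ
cost (var _)    = 1
cost nil        = 1
cost (cons e f) = suc (cost e + cost f)
cost (hd e)     = suc (cost e)
cost (tl e)     = suc (cost e)

-- c ⊢ s ⇓ s′ time t: started in store s, the command c halts in
-- store s′ after exactly t time units.
infix 4 _⊢_⇓_time_

data _⊢_⇓_time_ : Cmd → Store → Store → ℕ → Set where

  assign : ∀ {x e s} →
    x ≔ e ⊢ s ⇓ s [ x ↦ eval e s ] time suc (cost e)

  seq : ∀ {c₁ c₂ s s′ s″ t₁ t₂} →
    c₁ ⊢ s ⇓ s′ time t₁ →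
    c₂ ⊢ s′ ⇓ s″ time t₂ →
    c₁ ⨾ c₂ ⊢ s ⇓ s″ time t₁ + t₂

  if-true : ∀ {e c₁ c₂ s s′ t} →
    truth (eval e s) ≡ true →
    c₁ ⊢ s ⇓ s′ time t →
    if e then c₁ else c₂ ⊢ s ⇓ s′ time suc (cost e + t)

  if-false : ∀ {e c₁ c₂ s s′ t} →
    truth (eval e s) ≡ false →
    c₂ ⊢ s ⇓ s′ time t →
    if e then c₁ else c₂ ⊢ s ⇓ s′ time suc (cost e + t)

  while-true : ∀ {e c s s′ s″ t₁ t₂} →
    truth (eval e s) ≡ true →
    c ⊢ s ⇓ s′ time t₁ →
    while e loop c ⊢ s′ ⇓ s″ time t₂ →
    while e loop c ⊢ s ⇓ s″ time suc (cost e + (t₁ + t₂))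

  while-false : ∀ {e c s} →
    truth (eval e s) ≡ false →
    while e loop c ⊢ s ⇓ s time suc (cost e)

-- Variable 0 holds the input at the start and the output at the end; all
-- other variables start out as nil.
initial : Tree → Store
initial d zero    = d
initial d (suc _) = nil

-- A decision problem is given by a type of instances, their encoding as
-- trees, and the yes-instances.  Nothing is required of the program on
-- trees that encode no instance.  As size d ≥ 1, every polynomial in
-- size d is bounded by some c * size d ^ k.
DecidableInPolynomialTime : {A : Set} → (A → Tree) → (A → Set) → Set
DecidableInPolynomialTime {A} encode Yes =
  ∃[ P ] ∃[ c ] ∃[ k ] ((a : A) →
    ∃[ s ] ∃[ t ]
      P ⊢ initial (encode a) ⇓ s time t
      × t ≤ c * size (encode a) ^ k
      × (truth (s 0) ≡ true ⇔ Yes a))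

------------------------------------------------------------------------
-- Encoding of the input

encodeList : List Tree → Tree
encodeList []       = nil
encodeList (d ∷ ds) = cons d (encodeList ds)

encodeBool : Bool → Tree
encodeBool false = nil
encodeBool true  = cons nil nil

-- Binary with digits 2 (encoded as false) and 1 (as true), as in the
-- library, least significant digit first.  The size is logarithmic in
-- the number.
encodeℕᵇ : ℕᵇ → Tree
encodeℕᵇ ℕᵇ.zero  = nil
encodeℕᵇ 2[1+ x ] = cons (encodeBool false) (encodeℕᵇ x)
encodeℕᵇ 1+[2 x ] = cons (encodeBool true) (encodeℕᵇ x)

encodeℤ : ℤ → Tree
encodeℤ (+ m)    = cons (encodeBool false) (encodeℕᵇ (ℕᵇ.fromℕ m))
encodeℤ -[1+ m ] = cons (encodeBool true) (encodeℕᵇ (ℕᵇ.fromℕ m))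

-- The adjacency matrix, row by row.
encodeGraph : ∀ {n} → Graph n → Tree
encodeGraph G =
  encodeList (tabulate λ u → encodeList (tabulate λ v →
    encodeBool (Graph.adj G u v)))

record Instance : Set where
  field
    {order}          : ℕ
    graph            : Graph order
    permutationGraph : IsPermutationGraph graph
    b w              : ℤ

-- The program sees the graph only, not a diagram of it.
encodeInstance : Instance → Tree
encodeInstance I = cons (encodeGraph graph) (cons (encodeℤ b) (encodeℤ w))
  where open Instance I

HasColoring : Instance → Set
HasColoring I = HasBlackAndWhiteColoring graph b w
  where open Instance I

{-# OPTIONS --safe #-}

-- In a diagram, "left of" and "crosses from the upper left" transitively
-- orient the complement of G and G itself. The program does not see the
-- diagram, but it can recompute some transitive orientation F of the
-- complement: each class of edges that force each other is directed so that
-- it contains the lexicographically least ordered pair that the class or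
-- its reverse contains (Hell and Huang). Together with the orientation of
-- G, any such F is an intersection of two linear orders, so the common
-- upper bounds of a nonempty set of vertices are those of just two of its
-- members. In a coloring, the black vertices below all white ones, or the
-- white ones below all black ones, form a nonempty block that lies below
-- all other colored vertices. Splitting off one block after the other, one
-- only ever colors sets of common upper bounds of two vertices, so dynamic
-- programming over these pairs and the numbers of vertices still to be
-- colored applies.
--
-- The program is written in a first-order language in which every loop runs
-- n or n + 1 times, so that any term of the language compiles to a command
-- of polynomial running time.

module Submission where

open import Defs
open import Data.Bool.Base using (Bool; true; false; T)
  renaming (if_then_else_ to cond)
open import Data.Bool.Properties using (_≟_; T-≡; T?)
open import Data.Empty using (⊥)
open import Data.Fin.Base as Fin using (Fin; zero; suc; toℕ; fromℕ; inject₁; fromℕ<)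
open import Data.Fin.Induction using (spo-wellFounded)
open import Data.Fin.Permutation using (Permutation′; _⟨$⟩ʳ_)
open import Data.Fin.Properties as Finₚ
  using (any?; all?; ¬∀⟶∃¬; toℕ-fromℕ; toℕ-inject₁; toℕ<n; toℕ-injective; toℕ-fromℕ<)
open import Data.Fin.Subset
  using (Subset; _∈_; _∉_; _⊆_; _∪_; _∩_; _─_; ∣_∣; Nonempty)
open import Data.Fin.Subset.Properties
open import Data.Integer.Base using (ℤ; +_; -[1+_])
open import Data.Integer.Properties using (+-injective)
open import Data.List.Base as List using (List; []; _∷_; length)
open import Data.List.Properties using (length-tabulate)
open import Data.Nat.Base hiding (_≤ᵇ_; _<ᵇ_; pred)
import Data.Nat.Base as ℕ
open import Data.Nat.Binary.Base as ℕᵇ using (ℕᵇ; 2[1+_]; 1+[2_])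
import Data.Nat.Binary.Properties as ℕᵇ
open import Data.Nat.Properties hiding (_≟_)
open import Data.Product.Base using (_×_; _,_; proj₁; proj₂; ∃-syntax; swap)
open import Data.Rational.Base as ℚ using (ℚ; 0ℚ; 1ℚ; 1/_)
import Data.Rational.Properties as ℚ
open import Data.Rational.Solver using (module +-*-Solver)
open import Data.Sum.Base using (_⊎_; inj₁; inj₂; [_,_]; [_,_]′)
open import Data.Vec.Base as Vec using (Vec; []; _∷_; here; there)
open import Data.Vec.Properties using (lookup∘tabulate; lookup⇒[]=; []=⇒lookup)
open import Function.Base using (_∘_; id; flip)
open import Function.Bundles using (_⇔_; mk⇔; Equivalence; Injection)
open import Function.Construct.Identity using (⇔-id)
open import Function.Properties.Inverse using (↔⇒↣)
open import Induction.WellFounded using (Acc; acc)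
open import Relation.Binary.Definitions using (Transitive; tri<; tri≈; tri>)
open import Relation.Binary.PropositionalEquality hiding ([_])
open import Relation.Binary.Structures using (IsStrictPartialOrder)
open import Relation.Nullary.Decidable
  using (Dec; yes; no; does; _×-dec_; _→-dec_; _⊎-dec_; dec-true)
open import Relation.Nullary.Negation using (contradiction; ¬_)
open Equivalence

-- A first-order language of polynomial-time programs

-- Directing the forcing classes one by one risks a cyclic triangle whose sides lie in different
-- classes. The choice of the least pair excludes it: on a cycle u, v, w, moving uv to pq within its
-- class moves wu to wp by the triangle lemma, so the least vertex touched by the class of wu is at
-- most that of uv, and around the cycle all three agree. In this step the left-to-right order of
-- the diagram serves only to show that no class contains its own reverse. Colorings are relaxed to
-- at least the demanded numbers, so that a whole block can be colored even if a given coloring uses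
-- only part of it; the surplus is dropped at the end. Every block holds a colored vertex, so n
-- rounds of the table suffice. The targets `b` and `w` are binary and may be exponentially large,
-- so they are never expanded: all pairs of counts up to n are tried and compared with them digit by
-- digit.

data Extent : Set where
  card card+1 : Extent

-- A number of colored vertices takes the n + 1 values from 0 to n, a vertex only n.
extent : Extent → ℕ → ℕ
extent card   n = n
extent card+1 n = suc n

infixr 4 _⊗_

data Ty : Set where
  bool nat digits : Ty
  fin             : Extent → Ty
  vec             : Extent → Ty → Ty
  _⊗_             : Ty → Ty → Ty

⟦_⟧ᵗ : Ty → ℕ → Set
⟦ bool ⟧ᵗ    n = Bool
⟦ nat ⟧ᵗ     n = ℕ
⟦ digits ⟧ᵗ  n = List Bool
⟦ fin e ⟧ᵗ   n = Fin (extent e n)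
⟦ vec e A ⟧ᵗ n = Vec (⟦ A ⟧ᵗ n) (extent e n)
⟦ A ⊗ B ⟧ᵗ   n = ⟦ A ⟧ᵗ n × ⟦ B ⟧ᵗ n

unary : ℕ → Tree
unary zero    = nil
unary (suc m) = cons nil (unary m)

encodeVec : ∀ {A : Set} {m} → (A → Tree) → Vec A m → Tree
encodeVec f []       = nil
encodeVec f (x ∷ xs) = cons (f x) (encodeVec f xs)

enc : ∀ A {n} → ⟦ A ⟧ᵗ n → Tree
enc bool      b       = encodeBool b
enc nat       m       = unary m
enc digits    ds      = encodeList (List.map encodeBool ds)
enc (fin e)   i       = unary (toℕ i)
enc (vec e A) xs      = encodeVec (enc A) xs
enc (A ⊗ B)   (a , b) = cons (enc A a) (enc B b)

-- The machine can only test against `nil`; in these types `nil` singles out false, zero or the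
-- empty list.
data Testable : Ty → Set where
  bool   : Testable bool
  nat    : Testable nat
  digits : Testable digits
  fin    : ∀ {e} → Testable (fin e)

isPositive : ℕ → Bool
isPositive zero    = false
isPositive (suc _) = true

test : ∀ {A n} → Testable A → ⟦ A ⟧ᵗ n → Bool
test bool   b       = b
test nat    m       = isPositive m
test digits []      = false
test digits (_ ∷ _) = true
test fin    i       = isPositive (toℕ i)

Ctx : Set
Ctx = List Ty

infixr 5 _∷_
infix  9 _!!_

data Env (n : ℕ) : Ctx → Set where
  []  : Env n []
  _∷_ : ∀ {A Γ} → ⟦ A ⟧ᵗ n → Env n Γ → Env n (A ∷ Γ)

_!!_ : ∀ {n Γ} → Env n Γ → (i : Fin (length Γ)) → ⟦ List.lookup Γ i ⟧ᵗ n
(a ∷ γ) !! zero  = a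
(a ∷ γ) !! suc i = γ !! i

data Const : Ty → Set where
  ff tt : Const bool
  zero  : Const nat

data Op : Ty → Ty → Set where
  fst     : ∀ {A B} → Op (A ⊗ B) A
  snd     : ∀ {A B} → Op (A ⊗ B) B
  suc     : Op nat nat
  pred    : Op nat nat
  predᶠ   : ∀ {e} → Op (fin e) (fin e)
  number  : ∀ {e} → Op (fin e) nat
  digit   : Op digits bool
  further : Op digits digits

data Term : Ctx → Ty → Set
data Args (Γ : Ctx) : Ctx → Set

data Term where
  ref    : ∀ {Γ} (i : Fin (length Γ)) → Term Γ (List.lookup Γ i)
  const  : ∀ {Γ A} → Const A → Term Γ A
  op     : ∀ {Γ A B} → Op A B → Term Γ A → Term Γ B
  pair   : ∀ {Γ A B} → Term Γ A → Term Γ B → Term Γ (A ⊗ B)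
  ite    : ∀ {Γ A B} → Testable A → Term Γ A → Term Γ B → Term Γ B → Term Γ B
  lookup : ∀ {Γ e A} → Term Γ (vec e A) → Term Γ (fin e) → Term Γ A
  tab    : ∀ {Γ A} e → Term (fin e ∷ Γ) A → Term Γ (vec e A)
  fold   : ∀ {Γ A} e → Term Γ A → Term (A ∷ fin e ∷ Γ) A → Term Γ A
  wk     : ∀ {Γ A B} → Term Γ B → Term (A ∷ Γ) B
  call   : ∀ {Γ Δ A} → Term Δ A → Args Γ Δ → Term Γ A

data Args Γ where
  []  : Args Γ []
  _∷_ : ∀ {A Δ} → Term Γ A → Args Γ Δ → Args Γ (A ∷ Δ)

applyConst : ∀ {A n} → Const A → ⟦ A ⟧ᵗ n
applyConst ff   = false
applyConst tt   = true
applyConst zero = 0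

predFin : ∀ {m} → Fin m → Fin m
predFin zero    = zero
predFin (suc i) = inject₁ i

firstDigit : List Bool → Bool
firstDigit []      = false
firstDigit (d ∷ _) = d

applyOp : ∀ {A B n} → Op A B → ⟦ A ⟧ᵗ n → ⟦ B ⟧ᵗ n
applyOp fst     (a , _) = a
applyOp snd     (_ , b) = b
applyOp suc     m       = suc m
applyOp pred    m       = ℕ.pred m
applyOp predᶠ   i       = predFin i
applyOp number  i       = toℕ i
applyOp digit   ds      = firstDigit ds
applyOp further ds      = List.drop 1 ds

-- Indices descend as in a `countdown` loop, where after the decrement the counter register holds
-- the current index in unary.
iterate : ∀ {A : Set} m → (Fin m → A → A) → A → A
iterate zero    f a = a
iterate (suc m) f a = iterate m (f ∘ inject₁) (f (fromℕ m) a)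

-- Peeling off the last pass instead of the first shifts the remaining indices by `suc`, which suits
-- pattern matching on `Fin` and recursion on vectors.
iterate-suc : ∀ {A : Set} m (f : Fin (suc m) → A → A) a →
              iterate (suc m) f a ≡ f zero (iterate m (f ∘ suc) a)
iterate-suc zero    f a = refl
iterate-suc (suc m) f a = iterate-suc m (f ∘ inject₁) (f (fromℕ (suc m)) a)

⟦_⟧  : ∀ {Γ A n} → Term Γ A → Env n Γ → ⟦ A ⟧ᵗ n
⟦_⟧* : ∀ {Γ Δ n} → Args Γ Δ → Env n Γ → Env n Δ

⟦ ref i ⟧              γ       = γ !! i
⟦ const c ⟧            γ       = applyConst c
⟦ op o t ⟧             γ       = applyOp o (⟦ t ⟧ γ)
⟦ pair t u ⟧           γ       = ⟦ t ⟧ γ , ⟦ u ⟧ γ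
⟦ ite A t u v ⟧        γ       = cond (test A (⟦ t ⟧ γ)) (⟦ u ⟧ γ) (⟦ v ⟧ γ)
⟦ lookup t u ⟧         γ       = Vec.lookup (⟦ t ⟧ γ) (⟦ u ⟧ γ)
⟦ tab e t ⟧            γ       = Vec.tabulate λ i → ⟦ t ⟧ (i ∷ γ)
⟦ fold {A = A} e t u ⟧ γ       =
  iterate (extent e _) (λ i a → ⟦ u ⟧ (_∷_ {A = A} a (i ∷ γ))) (⟦ t ⟧ γ)
⟦ wk t ⟧               (_ ∷ γ) = ⟦ t ⟧ γ
⟦ call t us ⟧          γ       = ⟦ t ⟧ (⟦ us ⟧* γ)

⟦ [] ⟧*     γ = []
⟦ t ∷ us ⟧* γ = ⟦ t ⟧ γ ∷ ⟦ us ⟧* γ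

-- Compilation: the value of a term is left in register k, registers
-- below k are preserved, register 1 holds n in unary.

record Layout (Γ : Ctx) : Set where
  constructor layout
  field
    register : Fin (length Γ) → Var

open Layout

infixr 5 _▹_

_▹_ : ∀ {A Γ} → Var → Layout Γ → Layout (A ∷ Γ)
x ▹ ρ = layout λ { zero → x ; (suc i) → register ρ i }

constExpr : ∀ {A} → Const A → Expr
constExpr ff   = nil
constExpr tt   = cons nil nil
constExpr zero = nil

opExpr : ∀ {A B} → Op A B → Var → Expr
opExpr fst     x = hd (var x)
opExpr snd     x = tl (var x)
opExpr suc     x = cons nil (var x)
opExpr pred    x = tl (var x)
opExpr predᶠ   x = tl (var x)
opExpr number  x = var x
opExpr digit   x = hd (var x)
opExpr further x = tl (var x)

extentExpr : Extent → Expr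
extentExpr card   = var 1
extentExpr card+1 = cons nil (var 1)

countdown : Var → Cmd → Cmd
countdown x c = while var x loop (x ≔ tl (var x) ⨾ c)

compile     : ∀ {Γ A} → Term Γ A → Layout Γ → Var → Cmd
compileArgs : ∀ {Γ Δ} → Args Γ Δ → Layout Γ → Var → Cmd

compile (ref i)       ρ k = k ≔ var (register ρ i)
compile (const c)     ρ k = k ≔ constExpr c
compile (op o t)      ρ k = compile t ρ k ⨾ k ≔ opExpr o k
compile (pair t u)    ρ k = compile t ρ k ⨾ compile u ρ (1 + k)
                          ⨾ k ≔ cons (var k) (var (1 + k))
compile (ite _ t u v) ρ k = compile t ρ k
                          ⨾ if var k then compile u ρ k else compile v ρ k
compile (lookup t u)  ρ k = compile t ρ k ⨾ compile u ρ (1 + k)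
                          ⨾ countdown (1 + k) (k ≔ tl (var k))
                          ⨾ k ≔ hd (var k)
-- The last index is treated first, so consing onto register `k` yields the vector in order.
compile (tab e t)     ρ k = k ≔ nil ⨾ suc k ≔ extentExpr e
                          ⨾ countdown (1 + k)
                              (compile t (suc k ▹ ρ) (2 + k)
                              ⨾ k ≔ cons (var (2 + k)) (var k))
compile (fold {A = A} e t u) ρ k
                          = compile t ρ k ⨾ suc k ≔ extentExpr e
                          ⨾ countdown (1 + k)
                              (compile u (_▹_ {A} k (suc k ▹ ρ)) (2 + k)
                              ⨾ k ≔ var (2 + k))
compile (wk t)        ρ k = compile t (layout (register ρ ∘ suc)) k
-- The arguments occupy the registers from `k` on and form the environment of `t`, which works above
-- them.
compile (call {Δ = Δ} t us) ρ k
                          = compileArgs us ρ k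
                          ⨾ compile t (layout λ i → k + toℕ i) (k + length Δ)
                          ⨾ k ≔ var (k + length Δ)

compileArgs []       ρ k = k ≔ nil
compileArgs (t ∷ us) ρ k = compile t ρ k ⨾ compileArgs us ρ (1 + k)

-- Depends on `n` alone, not on stored values. The constants are costs of fixed commands: the 8 per
-- pass of a lookup is a test of 2 and two assignments of 3, the 5 of other loops a test and a
-- decrement, the final 2 the failing test.
timeBound     : ∀ {Γ A} → Term Γ A → ℕ → ℕ
timeBoundArgs : ∀ {Γ Δ} → Args Γ Δ → ℕ → ℕ

timeBound (ref i)       n = 2
timeBound (const c)     n = 4
timeBound (op o t)      n = timeBound t n + 4
timeBound (pair t u)    n = timeBound t n + (timeBound u n + 4)
timeBound (ite _ t u v) n = timeBound t n + (2 + (timeBound u n + timeBound v n))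
timeBound (lookup {e = e} t u) n
                        = timeBound t n + (timeBound u n + ((extent e n * 8 + 2) + 3))
timeBound (tab e t)     n = 2 + (4 + (extent e n * (5 + (timeBound t n + 4)) + 2))
timeBound (fold e t u)  n
                        = timeBound t n + (4 + (extent e n * (5 + (timeBound u n + 2)) + 2))
timeBound (wk t)        n = timeBound t n
timeBound (call t us)   n = timeBoundArgs us n + (timeBound t n + 2)

timeBoundArgs []       n = 2
timeBoundArgs (t ∷ us) n = timeBound t n + timeBoundArgs us n

-- Timed execution and correctness of the compiler

record Exec (c : Cmd) (s : Store) (bound : ℕ) (Q : Store → Set) : Set where
  constructor exec
  field
    {final} : Store
    {time}  : ℕ
    run     : c ⊢ s ⇓ final time time
    time≤   : time ≤ bound
    post    : Q final

Exec-map : ∀ {c s b b′} {Q R : Store → Set} →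
           b ≤ b′ → (∀ {s′} → Q s′ → R s′) → Exec c s b Q → Exec c s b′ R
Exec-map b≤b′ f (exec r t≤b q) = exec r (≤-trans t≤b b≤b′) (f q)

infixr 4 _>>=_

_>>=_ : ∀ {c d s a b} {Q R : Store → Set} → Exec c s a Q →
        (∀ {s′} → Q s′ → Exec d s′ b R) → Exec (c ⨾ d) s (a + b) R
exec r t≤a q >>= f with f q
... | exec r′ t′≤b q′ = exec (seq r r′) (+-mono-≤ t≤a t′≤b) q′

Exec-assign : ∀ {x e s b} {Q : Store → Set} →
              cost e < b → Q (s [ x ↦ eval e s ]) → Exec (x ≔ e) s b Q
Exec-assign cost<b q = exec assign cost<b q

-- Adding the bounds of the branches, rather than taking their maximum, leaves only sums and
-- products to be bounded by polynomials.
Exec-if : ∀ {e c d s a b} {Q : Store → Set} p → truth (eval e s) ≡ p →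
          (p ≡ true → Exec c s a Q) → (p ≡ false → Exec d s b Q) →
          Exec (if e then c else d) s (suc (cost e) + (a + b)) Q
Exec-if {a = a} {b} true  ≡true  f g with f refl
... | exec r t≤a q =
  exec (if-true ≡true r) (+-monoʳ-≤ _ (≤-trans t≤a (m≤m+n a b))) q
Exec-if {a = a} {b} false ≡false f g with g refl
... | exec r t≤b q =
  exec (if-false ≡false r) (+-monoʳ-≤ _ (≤-trans t≤b (m≤n+m b a))) q

update-at : ∀ s x {d} → (s [ x ↦ d ]) x ≡ d
update-at s x with x ≡ᵇ x | ≡⇒≡ᵇ x x refl
... | true | _ = refl

update-off : ∀ s {x y d} → x ≢ y → (s [ x ↦ d ]) y ≡ s y
update-off s {x} {y} x≢y with x ≡ᵇ y in eq
... | false = refl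
... | true  = contradiction (≡ᵇ⇒≡ x y (subst T (sym eq) _)) x≢y

AgreeBelow : Var → Store → Store → Set
AgreeBelow k s s′ = ∀ {x} → x < k → s′ x ≡ s x

agree-trans : ∀ {k l s s′ s″} → k ≤ l →
              AgreeBelow k s s′ → AgreeBelow l s′ s″ → AgreeBelow k s s″
agree-trans k≤l f g x<k = trans (g (<-≤-trans x<k k≤l)) (f x<k)

agree-update : ∀ {k l d} s → k ≤ l → AgreeBelow k s (s [ l ↦ d ])
agree-update s k≤l x<k = update-off s (≢-sym (<⇒≢ (<-≤-trans x<k k≤l)))

k<1+k : ∀ {k} → k < 1 + k
k<1+k = ≤-refl

-- The invariant `I` ties the iterated value to the store. It must survive any write to the counter,
-- since the decrement precedes the body, and the body must hand the counter back intact for the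
-- next test.
Exec-countdown :
  ∀ {B : Set} {x c b} {I : B → Store → Set} →
  ∀ m (f : Fin m → B → B) {s a} → s x ≡ unary m → I a s →
  (∀ {s a} → I a s → (d : Tree) → I a (s [ x ↦ d ])) →
  (∀ i {s a} → s x ≡ unary (toℕ i) → I a s →
     Exec c s b (λ s′ → s′ x ≡ unary (toℕ i) × I (f i a) s′)) →
  Exec (countdown x c) s (m * (5 + b) + 2) (I (iterate m f a))
Exec-countdown zero f eq Ia _ _ =
  exec (while-false (cong truth eq)) ≤-refl Ia
Exec-countdown {x = x} {c} {b} {I} (suc m) f {s} {a} eq Ia stable body
  with body (fromℕ m)
         (trans (update-at s x) (trans (cong tail eq) (cong unary (sym (toℕ-fromℕ m)))))
         (stable Ia _)
... | exec r t≤b (eq′ , Ia′)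
  with Exec-countdown {I = I} m (f ∘ inject₁)
         (trans eq′ (cong unary (toℕ-fromℕ m))) Ia′ stable
         (λ i {s} {a} → subst
            (λ j → s x ≡ unary j → I a s →
                   Exec c s b (λ s′ → s′ x ≡ unary j × I (f (inject₁ i) a) s′))
            (toℕ-inject₁ i) (body (inject₁ i)))
... | exec r′ t′≤ Ia″ =
  exec (while-true (cong truth eq) (seq assign r) r′)
       (≤-trans (+-monoʳ-≤ 5 (+-mono-≤ t≤b t′≤))
                (≤-reflexive (sym (+-assoc (5 + b) _ 2))))
       Ia″

truth-unary : ∀ m → truth (unary m) ≡ isPositive m
truth-unary zero    = refl
truth-unary (suc _) = refl

test-correct : ∀ {A n} (P : Testable A) (a : ⟦ A ⟧ᵗ n) → truth (enc A a) ≡ test P a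
test-correct bool   false   = refl
test-correct bool   true    = refl
test-correct nat    m       = truth-unary m
test-correct digits []      = refl
test-correct digits (_ ∷ _) = refl
test-correct fin    i       = truth-unary (toℕ i)

constExpr-correct : ∀ {A n} (c : Const A) s →
                    eval (constExpr c) s ≡ enc A {n} (applyConst c)
constExpr-correct ff   s = refl
constExpr-correct tt   s = refl
constExpr-correct zero s = refl

constExpr-cost : ∀ {A} (c : Const A) → cost (constExpr c) ≤ 3
constExpr-cost ff   = s≤s z≤n
constExpr-cost tt   = ≤-refl
constExpr-cost zero = s≤s z≤n

tail-unary : ∀ m → tail (unary m) ≡ unary (ℕ.pred m)
tail-unary zero    = refl
tail-unary (suc m) = refl

toℕ-predFin : ∀ {m} (i : Fin m) → toℕ (predFin i) ≡ ℕ.pred (toℕ i)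
toℕ-predFin zero    = refl
toℕ-predFin (suc i) = toℕ-inject₁ i

opExpr-correct : ∀ {A B n} (o : Op A B) {s x} (a : ⟦ A ⟧ᵗ n) → s x ≡ enc A a →
                 eval (opExpr o x) s ≡ enc B (applyOp o a)
opExpr-correct fst     a        eq = cong head eq
opExpr-correct snd     a        eq = cong tail eq
opExpr-correct suc     m        eq = cong (cons nil) eq
opExpr-correct pred    m        eq = trans (cong tail eq) (tail-unary m)
opExpr-correct predᶠ   i        eq =
  trans (cong tail eq) (trans (tail-unary (toℕ i)) (cong unary (sym (toℕ-predFin i))))
opExpr-correct number  i        eq = eq
opExpr-correct digit   []       eq = cong head eq
opExpr-correct digit   (_ ∷ _)  eq = cong head eq
opExpr-correct further []       eq = cong tail eq
opExpr-correct further (_ ∷ _)  eq = cong tail eq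

opExpr-cost : ∀ {A B} (o : Op A B) x → cost (opExpr o x) ≤ 3
opExpr-cost fst     x = s≤s (s≤s z≤n)
opExpr-cost snd     x = s≤s (s≤s z≤n)
opExpr-cost suc     x = ≤-refl
opExpr-cost pred    x = s≤s (s≤s z≤n)
opExpr-cost predᶠ   x = s≤s (s≤s z≤n)
opExpr-cost number  x = s≤s z≤n
opExpr-cost digit   x = s≤s (s≤s z≤n)
opExpr-cost further x = s≤s (s≤s z≤n)

-- Registers 0 and 1 lie below every admissible `k`, so compiled code changes neither the input nor
-- the clock.
record Represents {n Γ} (ρ : Layout Γ) (k : Var) (γ : Env n Γ) (s : Store) : Set where
  field
    1<k   : 1 < k
    clock : s 1 ≡ unary n
    below : ∀ i → register ρ i < k
    holds : ∀ i → s (register ρ i) ≡ enc (List.lookup Γ i) (γ !! i)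

open Represents

extentExpr-correct : ∀ e {n s} → s 1 ≡ unary n → eval (extentExpr e) s ≡ unary (extent e n)
extentExpr-correct card   eq = eq
extentExpr-correct card+1 eq = cong (cons nil) eq

extentExpr-cost : ∀ e → cost (extentExpr e) ≤ 3
extentExpr-cost card   = s≤s z≤n
extentExpr-cost card+1 = ≤-refl

represents-agree : ∀ {n Γ ρ k l s s′} {γ : Env n Γ} → k ≤ l → AgreeBelow k s s′ →
                   Represents ρ k γ s → Represents ρ l γ s′
represents-agree k≤l ag R = record
  { 1<k   = ≤-trans (1<k R) k≤l
  ; clock = trans (ag (1<k R)) (clock R)
  ; below = λ i → ≤-trans (below R i) k≤l
  ; holds = λ i → trans (ag (below R i)) (holds R i)
  }

represents-extend : ∀ {n Γ ρ k l x s s′} {γ : Env n Γ} {A} {a : ⟦ A ⟧ᵗ n} →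
                    k ≤ l → AgreeBelow k s s′ →
                    x < l → s′ x ≡ enc A a → Represents ρ k γ s →
                    Represents (_▹_ {A} x ρ) l (a ∷ γ) s′
represents-extend k≤l ag x<l eq R = record
  { 1<k   = 1<k R′ ; clock = clock R′
  ; below = λ { zero → x<l ; (suc i) → below R′ i }
  ; holds = λ { zero → eq  ; (suc i) → holds R′ i }
  } where R′ = represents-agree k≤l ag R

Computes : ∀ {A n} → Var → Store → ⟦ A ⟧ᵗ n → Store → Set
Computes {A} k s a s′ = s′ k ≡ enc A a × AgreeBelow k s s′

finish : ∀ {k s s′ d} → AgreeBelow k s s′ → AgreeBelow k s (s′ [ k ↦ d ])
finish {s′ = s′} ag = agree-trans ≤-refl ag (agree-update s′ ≤-refl)

-- The bound uses the length of the vector instead of the index, which keeps it independent of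
-- values.
Exec-lookup : ∀ {A : Set} {m} (f : A → Tree) (xs : Vec A m) (i : Fin m) {k s} →
              s k ≡ encodeVec f xs → s (1 + k) ≡ unary (toℕ i) →
              Exec (countdown (1 + k) (k ≔ tl (var k))) s (m * 8 + 2)
                (λ s′ → head (s′ k) ≡ f (Vec.lookup xs i) × AgreeBelow k s s′)
Exec-lookup {m = m} f (x ∷ xs) zero eqₖ eq =
  exec (while-false (cong truth eq)) (m≤n+m 2 (m * 8))
       (cong head eqₖ , λ _ → refl)
Exec-lookup {m = suc m} f (x ∷ xs) (suc i) {k} {s} eqₖ eq
  with Exec-lookup f xs i {k}
         {(s [ 1 + k ↦ tail (s (1 + k)) ]) [ k ↦ tail ((s [ 1 + k ↦ tail (s (1 + k)) ]) k) ]}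
         (trans (update-at _ k)
           (cong tail (trans (update-off s (≢-sym (<⇒≢ (k<1+k {k})))) eqₖ)))
         (trans (update-off _ (<⇒≢ (k<1+k {k})))
           (trans (update-at s (1 + k)) (cong tail eq)))
... | exec r t≤ (res , ag) =
  exec (while-true (cong truth eq) (seq assign assign) r)
       (+-monoʳ-≤ 8 t≤)
       (res , agree-trans ≤-refl (finish (agree-update s (n≤1+n k))) ag)

encodeVec-tabulate : ∀ {A : Set} m (f : Fin m → A) (g : A → Tree) →
                     iterate m (λ i → cons (g (f i))) nil ≡ encodeVec g (Vec.tabulate f)
encodeVec-tabulate zero    f g = refl
encodeVec-tabulate (suc m) f g =
  trans (iterate-suc m (λ i → cons (g (f i))) nil)
        (cong (cons (g (f zero))) (encodeVec-tabulate m (f ∘ suc) g))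

-- Preservation of the registers below `k` is proved along with the value, because second operands
-- and loop bodies run while earlier results are still needed.
compile-correct :
  ∀ {n Γ A} (t : Term Γ A) {ρ k s} {γ : Env n Γ} → Represents ρ k γ s →
  Exec (compile t ρ k) s (timeBound t n) (Computes {A} k s (⟦ t ⟧ γ))
compileArgs-correct :
  ∀ {n Γ Δ} (us : Args Γ Δ) {ρ k s} {γ : Env n Γ} → Represents ρ k γ s →
  Exec (compileArgs us ρ k) s (timeBoundArgs us n) λ s′ →
    (∀ i → s′ (k + toℕ i) ≡ enc (List.lookup Δ i) (⟦ us ⟧* γ !! i)) × AgreeBelow k s s′

compile-correct (ref i) {k = k} {s} R =
  Exec-assign ≤-refl (trans (update-at s k) (holds R i) , agree-update s ≤-refl)
compile-correct (const c) {k = k} {s} R =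
  Exec-assign (s≤s (constExpr-cost c))
    (trans (update-at s k) (constExpr-correct c s) , agree-update s ≤-refl)
compile-correct (op o t) {k = k} {γ = γ} R =
  compile-correct t R >>= λ {s′} (eq , ag) →
  Exec-assign (s≤s (opExpr-cost o k))
    (trans (update-at s′ k) (opExpr-correct o (⟦ t ⟧ γ) eq) , finish ag)
compile-correct (pair t u) {k = k} R =
  compile-correct t R >>= λ (eq , ag) →
  compile-correct u (represents-agree (n≤1+n _) ag R) >>= λ {s″} (eq′ , ag′) →
  Exec-assign ≤-refl
    ( trans (update-at s″ k) (cong₂ cons (trans (ag′ k<1+k) eq) eq′)
    , finish (agree-trans (n≤1+n _) ag ag′))
compile-correct (ite P t u v) {γ = γ} R =
  compile-correct t R >>= λ (eq , ag) →
  Exec-if (test P (⟦ t ⟧ γ)) (trans (cong truth eq) (test-correct P (⟦ t ⟧ γ)))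
    (λ is-true → Exec-map ≤-refl
       (λ {s″} (eq′ , ag′) → trans eq′
          (cong (λ p → enc _ (cond p (⟦ u ⟧ γ) (⟦ v ⟧ γ))) (sym is-true))
          , agree-trans {s″ = s″} ≤-refl ag ag′)
       (compile-correct u (represents-agree ≤-refl ag R)))
    (λ is-false → Exec-map ≤-refl
       (λ {s″} (eq′ , ag′) → trans eq′
          (cong (λ p → enc _ (cond p (⟦ u ⟧ γ) (⟦ v ⟧ γ))) (sym is-false))
          , agree-trans {s″ = s″} ≤-refl ag ag′)
       (compile-correct v (represents-agree ≤-refl ag R)))
compile-correct (lookup {A = A} t u) {k = k} {γ = γ} R =
  compile-correct t R >>= λ (eq , ag) →
  compile-correct u (represents-agree (n≤1+n _) ag R) >>= λ (eq′ , ag′) →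
  Exec-lookup (enc A) (⟦ t ⟧ γ) (⟦ u ⟧ γ) (trans (ag′ k<1+k) eq) eq′ >>=
  λ {s‴} (eq″ , ag″) →
  Exec-assign ≤-refl
    ( trans (update-at s‴ k) eq″
    , finish (agree-trans ≤-refl (agree-trans (n≤1+n _) ag ag′) ag″))
compile-correct {n} (tab {A = A} e t) {ρ} {k} {s} {γ} R =
  Exec-assign {s = s} {Q = λ s′ → s′ k ≡ nil × AgreeBelow k s s′}
    ≤-refl (update-at s k , agree-update s ≤-refl) >>= λ {s′} (eq , ag) →
  Exec-assign {s = s′}
    {Q = λ s″ → s″ (1 + k) ≡ unary (extent e n) × s″ k ≡ nil × AgreeBelow k s s″}
    (s≤s (extentExpr-cost e))
    ( trans (update-at s′ (1 + k)) (extentExpr-correct e (trans (ag (1<k R)) (clock R)))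
    , trans (agree-update s′ ≤-refl k<1+k) eq
    , agree-trans ≤-refl ag (agree-update s′ (n≤1+n k))) >>= λ (eq′ , I₀) →
  Exec-map ≤-refl
    (λ (eq″ , ag″) → trans eq″ (encodeVec-tabulate (extent e n) _ (enc A)) , ag″)
    (Exec-countdown {I = I} (extent e n) (λ i → cons (enc A (⟦ t ⟧ (i ∷ γ)))) eq′ I₀
      (λ {s″} (eq″ , ag″) d →
         trans (agree-update s″ ≤-refl k<1+k) eq″ ,
         agree-trans ≤-refl ag″ (agree-update s″ (n≤1+n k)))
      λ i (eqᵢ) (eq″ , ag″) →
        compile-correct t
          (represents-extend (m≤n+m k 2) ag″ k<1+k eqᵢ R) >>= λ {s⁗} (eq‴ , ag‴) →
        Exec-assign ≤-refl
          ( trans (update-off s⁗ (<⇒≢ (k<1+k {k}))) (trans (ag‴ k<1+k) eqᵢ)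
          , trans (update-at s⁗ k)
              (cong₂ cons eq‴ (trans (ag‴ (m≤n⇒m≤1+n k<1+k)) eq″))
          , finish (agree-trans (m≤n+m k 2) ag″ ag‴)))
  where
  I : Tree → Store → Set
  I d s′ = s′ k ≡ d × AgreeBelow k s s′
compile-correct {n} (fold {A = A} e t u) {ρ} {k} {s} {γ} R =
  compile-correct t R >>= λ {s′} (eq , ag) →
  Exec-assign {s = s′}
    {Q = λ s″ → s″ (1 + k) ≡ unary (extent e n) × I (⟦ t ⟧ γ) s″}
    (s≤s (extentExpr-cost e))
    ( trans (update-at s′ (1 + k)) (extentExpr-correct e (trans (ag (1<k R)) (clock R)))
    , trans (agree-update s′ ≤-refl k<1+k) eq
    , agree-trans ≤-refl ag (agree-update s′ (n≤1+n k))) >>= λ (eq′ , I₀) →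
  Exec-countdown {I = I} (extent e n) _ eq′ I₀
    (λ {s″} (eq″ , ag″) d →
       trans (agree-update s″ ≤-refl k<1+k) eq″ ,
       agree-trans ≤-refl ag″ (agree-update s″ (n≤1+n k)))
    λ i eqᵢ (eq″ , ag″) →
      compile-correct u
        (represents-extend ≤-refl (λ _ → refl) (m≤n⇒m≤1+n k<1+k) eq″
          (represents-extend (m≤n+m k 2) ag″ k<1+k eqᵢ R)) >>= λ {s⁗} (eq‴ , ag‴) →
      Exec-assign ≤-refl
        ( trans (update-off s⁗ (<⇒≢ (k<1+k {k}))) (trans (ag‴ k<1+k) eqᵢ)
        , trans (update-at s⁗ k) eq‴
        , finish (agree-trans (m≤n+m k 2) ag″ ag‴))
  where
  I : ⟦ A ⟧ᵗ n → Store → Set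
  I a s′ = s′ k ≡ enc A a × AgreeBelow k s s′
compile-correct (wk t) {ρ} {γ = _ ∷ γ} R = compile-correct t record
  { 1<k = 1<k R ; clock = clock R ; below = below R ∘ suc ; holds = holds R ∘ suc }
compile-correct {n} (call {Δ = Δ} t us) {k = k} {s} {γ} R =
  compileArgs-correct us R >>= λ {s′} (eqs , ag) →
  compile-correct t {γ = ⟦ us ⟧* γ} record
    { 1<k   = ≤-trans (1<k R) (m≤m+n k _)
    ; clock = trans (ag (1<k R)) (clock R)
    ; below = λ i → +-monoʳ-< k (toℕ<n i)
    ; holds = eqs
    } >>= λ {s″} (eq , ag′) →
  Exec-assign ≤-refl
    (trans (update-at s″ k) eq , finish (agree-trans (m≤m+n k _) ag ag′))

compileArgs-correct [] {k = k} {s} R =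
  Exec-assign ≤-refl ((λ ()) , agree-update s ≤-refl)
compileArgs-correct {Δ = A ∷ Δ} (t ∷ us) {k = k} {s} {γ} R =
  compile-correct t R >>= λ {s′} (eq , ag) →
  Exec-map ≤-refl
    (λ {s″} (eqs , ag′) →
       (λ { zero    → trans (cong s″ (+-identityʳ k)) (trans (ag′ k<1+k) eq)
          ; (suc i) → trans (cong s″ (+-suc k (toℕ i))) (eqs i) })
       , agree-trans {s″ = s″} (n≤1+n k) ag ag′)
    (compileArgs-correct us (represents-agree (n≤1+n k) ag R))

-- Polynomial bounds

-- The base 2 + n is positive even for n = 0, so exponents may be raised when bounds are added, and
-- it is still at most the size of an encoded instance of order n.
Polynomial : (ℕ → ℕ) → Set
Polynomial f = ∃[ c ] ∃[ d ] ∀ n → f n ≤ c * (2 + n) ^ d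

poly-const : ∀ c → Polynomial λ _ → c
poly-const c = c , 0 , λ _ → ≤-reflexive (sym (*-identityʳ c))

poly-extent : ∀ e → Polynomial (extent e)
poly-extent e = 1 , 1 , λ n →
  ≤-trans (extent≤ e n) (≤-reflexive (sym (trans (*-identityˡ _) (*-identityʳ (2 + n)))))
  where
  extent≤ : ∀ e n → extent e n ≤ 2 + n
  extent≤ card   n = m≤n+m n 2
  extent≤ card+1 n = n≤1+n (suc n)

poly-+ : ∀ {f g} → Polynomial f → Polynomial g → Polynomial λ n → f n + g n
poly-+ {f} {g} (c , d , f≤) (c′ , d′ , g≤) = c + c′ , d + d′ , λ n → begin
  f n + g n                                              ≤⟨ +-mono-≤ (f≤ n) (g≤ n) ⟩
  c * (2 + n) ^ d + c′ * (2 + n) ^ d′                    ≤⟨ +-mono-≤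
    (*-monoʳ-≤ c (^-monoʳ-≤ (2 + n) (m≤m+n d d′)))
    (*-monoʳ-≤ c′ (^-monoʳ-≤ (2 + n) (m≤n+m d′ d))) ⟩
  c * (2 + n) ^ (d + d′) + c′ * (2 + n) ^ (d + d′)       ≡⟨ *-distribʳ-+ ((2 + n) ^ (d + d′)) c c′ ⟨
  (c + c′) * (2 + n) ^ (d + d′)                          ∎
  where open ≤-Reasoning

poly-* : ∀ {f g} → Polynomial f → Polynomial g → Polynomial λ n → f n * g n
poly-* {f} {g} (c , d , f≤) (c′ , d′ , g≤) = c * c′ , d + d′ , λ n → begin
  f n * g n                                  ≤⟨ *-mono-≤ (f≤ n) (g≤ n) ⟩
  c * (2 + n) ^ d * (c′ * (2 + n) ^ d′)      ≡⟨ [m*n]*[o*p]≡[m*o]*[n*p] c _ c′ _ ⟩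
  c * c′ * ((2 + n) ^ d * (2 + n) ^ d′)      ≡⟨ cong (c * c′ *_) (^-distribˡ-+-* (2 + n) d d′) ⟨
  c * c′ * (2 + n) ^ (d + d′)                ∎
  where open ≤-Reasoning

timeBound-poly     : ∀ {Γ A} (t : Term Γ A) → Polynomial (timeBound t)
timeBoundArgs-poly : ∀ {Γ Δ} (us : Args Γ Δ) → Polynomial (timeBoundArgs us)

timeBound-poly (ref i)       = poly-const 2
timeBound-poly (const c)     = poly-const 4
timeBound-poly (op o t)      = poly-+ (timeBound-poly t) (poly-const 4)
timeBound-poly (pair t u)    =
  poly-+ (timeBound-poly t) (poly-+ (timeBound-poly u) (poly-const 4))
timeBound-poly (ite _ t u v) = poly-+ (timeBound-poly t)
  (poly-+ (poly-const 2) (poly-+ (timeBound-poly u) (timeBound-poly v)))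
timeBound-poly (lookup {e = e} t u) = poly-+ (timeBound-poly t) (poly-+ (timeBound-poly u)
  (poly-+ (poly-+ (poly-* (poly-extent e) (poly-const 8)) (poly-const 2)) (poly-const 3)))
timeBound-poly (tab e t)     = poly-+ (poly-const 2) (poly-+ (poly-const 4) (poly-+
  (poly-* (poly-extent e) (poly-+ (poly-const 5) (poly-+ (timeBound-poly t) (poly-const 4))))
  (poly-const 2)))
timeBound-poly (fold e t u)  = poly-+ (timeBound-poly t) (poly-+ (poly-const 4) (poly-+
  (poly-* (poly-extent e) (poly-+ (poly-const 5) (poly-+ (timeBound-poly u) (poly-const 2))))
  (poly-const 2)))
timeBound-poly (wk t)        = timeBound-poly t
timeBound-poly (call t us)   =
  poly-+ (timeBoundArgs-poly us) (poly-+ (timeBound-poly t) (poly-const 2))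

timeBoundArgs-poly []       = poly-const 2
timeBoundArgs-poly (t ∷ us) = poly-+ (timeBound-poly t) (timeBoundArgs-poly us)

-- Transitive orientations

Rel : Set → Set₁
Rel A = A → A → Set

Pair : ℕ → Set
Pair n = Fin n × Fin n

-- Gallai's forcing relation, made reflexive on the edges of H.
Forces : ∀ {n} → Rel (Fin n) → Rel (Pair n)
Forces H (u , v) (x , y) = H u v × H x y × (u ≡ x × ¬ H v y ⊎ v ≡ y × ¬ H u x)

-- The transitive closure by its universal property, so that the theory applies directly to the
-- matrix that the program computes; `least` plays the part of induction on chains.
record IsClosure {A : Set} (S R : Rel A) : Set₁ where
  field
    step       : ∀ {p q} → S p q → R p q
    transitive : Transitive R
    least      : (Q : Rel A) → Transitive Q → (∀ {p q} → S p q → Q p q) →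
                 ∀ {p q} → R p q → Q p q

module _ {n} (R : Rel (Pair n)) where

  Touches : Fin n → Fin n → Fin n → Fin n → Set
  Touches u v p r = R (u , v) (p , r) ⊎ R (u , v) (r , p)

  record LeastTouched (u v p r : Fin n) : Set where
    constructor leastTouched
    field
      touches : Touches u v p r
      p-least : ∀ {p′} → p′ Fin.< p → ∀ r′ → ¬ Touches u v p′ r′
      r-least : ∀ {r′} → r′ Fin.< r → ¬ Touches u v p r′

open LeastTouched

least-unique : ∀ {n} {R : Rel (Pair n)} {u v p r p′ r′} →
               LeastTouched R u v p r → LeastTouched R u v p′ r′ →
               (p , r) ≡ (p′ , r′)
least-unique {p = p} {r} {p′} {r′} l l′ with Finₚ.<-cmp p p′
... | tri< p<p′ _ _ = contradiction (touches l) (p-least l′ p<p′ _)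
... | tri> _ _ p′<p = contradiction (touches l′) (p-least l p′<p _)
... | tri≈ _ refl _ with Finₚ.<-cmp r r′
... | tri< r<r′ _ _ = contradiction (touches l) (r-least l′ r<r′)
... | tri> _ _ r′<r = contradiction (touches l′) (r-least l r′<r)
... | tri≈ _ refl _ = refl

record IsTransitiveOrientation {n} (H P : Rel (Fin n)) : Set where
  field
    sound   : ∀ {u v} → P u v → H u v
    total   : ∀ {u v} → H u v → P u v ⊎ P v u
    P-trans : Transitive P

module Orientation
  {n} {H : Rel (Fin n)} (H? : ∀ u v → Dec (H u v))
  (H-sym : ∀ {u v} → H u v → H v u) (H-irrefl : ∀ {u} → ¬ H u u)
  {P : Rel (Fin n)} (P-orients : IsTransitiveOrientation H P)
  {R : Rel (Pair n)} (R-closure : IsClosure (Forces H) R)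
  {F : Rel (Fin n)}
  (F⇔ : ∀ u v → F u v ⇔ (H u v × ∃[ p ] ∃[ r ] LeastTouched R u v p r × R (u , v) (p , r)))
  (touched : ∀ u v → R (u , v) (u , v) → ∃[ p ] ∃[ r ] LeastTouched R u v p r)
  where

  open IsTransitiveOrientation P-orients
  open IsClosure R-closure renaming (transitive to R-trans)

  R-refl : ∀ {u v} → H u v → R (u , v) (u , v)
  R-refl Huv = step (Huv , Huv , inj₁ (refl , H-irrefl))

  R-sym : ∀ {p q} → R p q → R q p
  R-sym = least (flip R) (flip R-trans) λ (Hp , Hq , f) → step (Hq , Hp ,
    [ (λ (e , ¬H) → inj₁ (sym e , ¬H ∘ H-sym))
    , (λ (e , ¬H) → inj₂ (sym e , ¬H ∘ H-sym)) ] f)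

  R-swap : ∀ {p q} → R p q → R (swap p) (swap q)
  R-swap = least (λ p q → R (swap p) (swap q)) R-trans
    λ (Hp , Hq , f) → step (H-sym Hp , H-sym Hq , [ inj₂ , inj₁ ] f)

  R⇒H : ∀ {u v q} → R (u , v) q → H u v
  R⇒H = least (λ p q → H (proj₁ p) (proj₂ p)) (λ x _ → x) proj₁

  -- If `P` directed a forced edge the other way, transitivity would join the two endpoints that
  -- forcing requires to be unrelated.
  R-preserves-P : ∀ {u v x y} → R (u , v) (x , y) → P u v → P x y
  R-preserves-P = least (λ p q → P (proj₁ p) (proj₂ p) → P (proj₁ q) (proj₂ q))
    (λ f g → g ∘ f) forced
    where
    forced : ∀ {p q} → Forces H p q → P (proj₁ p) (proj₂ p) → P (proj₁ q) (proj₂ q)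
    forced (_ , Hxy , f) Puv with total Hxy | f
    ... | inj₁ Pxy | _                 = Pxy
    ... | inj₂ Pyx | inj₁ (refl , ¬H) = contradiction (H-sym (sound (P-trans Pyx Puv))) ¬H
    ... | inj₂ Pyx | inj₂ (refl , ¬H) = contradiction (sound (P-trans Puv Pyx)) ¬H

  -- A class containing its own reverse would make `P` direct an edge both ways. All later facts
  -- draw on the existence of `P` through this one.
  R-asym : ∀ {u v} → ¬ R (u , v) (v , u)
  R-asym Ruvvu with total (R⇒H Ruvvu)
  ... | inj₁ Puv = H-irrefl (sound (P-trans Puv (R-preserves-P Ruvvu Puv)))
  ... | inj₂ Pvu = H-irrefl (sound (P-trans Pvu (R-preserves-P (R-swap Ruvvu) Pvu)))

  -- `a` is the apex opposite the side bc that moves through its class. The class must contain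
  -- neither of the pairs ac and ba, which agree with bc in one coordinate.
  Triangle : Fin n → Pair n → Set
  Triangle a (b , c) = H a b × H a c × ¬ R (b , c) (a , c) × ¬ R (b , c) (b , a)

  -- The triangle lemma of the theory of implication classes.
  triangle : ∀ {a b c b′ c′} → R (b , c) (b′ , c′) → Triangle a (b , c) →
             R (a , b) (a , b′) × R (a , c) (a , c′)
  triangle {a} Rp t = proj₂ (least S S-trans forced Rp t)
    where
    -- The triangle conditions are carried along, since each forcing step relies on them for the
    -- current side.
    S : Rel (Pair n)
    S (b , c) (b′ , c′) = Triangle a (b , c) →
      Triangle a (b′ , c′) × R (a , b) (a , b′) × R (a , c) (a , c′)
    S-trans : Transitive S
    S-trans f g t = let t′ , x , y = f t ; t″ , x′ , y′ = g t′ in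
      t″ , R-trans x x′ , R-trans y y′
    forced : ∀ {p q} → Forces H p q → S p q
    forced {b , c} {_ , c′} Fo@(Hbc , Hbc′ , inj₁ (refl , ¬Hcc′)) (Hab , Hac , ¬ac , ¬ba)
      with H? a c′
    -- Without the edge ac′, ab would force c′b, and the reversed pairs would put ba into the class
    -- of bc.
    ... | no ¬Hac′ = contradiction
            (R-trans (step Fo)
              (R-sym (R-swap (step (Hab , H-sym Hbc′ , inj₂ (refl , ¬Hac′)))))) ¬ba
    ... | yes Hac′ =
            ( Hab , Hac′
            , (λ x → ¬ac (R-trans (step Fo) (R-trans x (R-sym Rac))))
            , (λ x → ¬ba (R-trans (step Fo) x)))
            , R-refl Hab , Rac
      where Rac = step (Hac , Hac′ , inj₁ (refl , ¬Hcc′))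
    forced {b , c} {b′ , _} Fo@(Hbc , Hb′c , inj₂ (refl , ¬Hbb′)) (Hab , Hac , ¬ac , ¬ba)
      with H? a b′
    ... | no ¬Hab′ = contradiction
            (R-trans (step Fo) (R-sym (step (Hac , Hb′c , inj₂ (refl , ¬Hab′))))) ¬ac
    ... | yes Hab′ =
            ( Hab′ , Hac
            , (λ x → ¬ac (R-trans (step Fo) x))
            , (λ x → ¬ba (R-trans (step Fo) (R-trans x (R-sym (R-swap Rab))))))
            , Rab , R-refl Hac
      where Rab = step (Hab , Hab′ , inj₁ (refl , ¬Hbb′))

  least-resp : ∀ {u v x y p r} → (∀ {p r} → Touches R u v p r → Touches R x y p r) →
               (∀ {p r} → Touches R x y p r → Touches R u v p r) →
               LeastTouched R u v p r → LeastTouched R x y p r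
  least-resp f g (leastTouched t p< r<) =
    leastTouched (f t) (λ x r → p< x r ∘ g) (λ x → r< x ∘ g)

  touches-swap : ∀ {u v p r} → Touches R u v p r → Touches R v u p r
  touches-swap = [ inj₂ ∘ R-swap , inj₁ ∘ R-swap ]

  touches-R : ∀ {u v x y p r} → R (x , y) (u , v) → Touches R u v p r → Touches R x y p r
  touches-R Rp = [ inj₁ ∘ R-trans Rp , inj₂ ∘ R-trans Rp ]

  least-swap : ∀ {u v p r} → LeastTouched R u v p r → LeastTouched R v u p r
  least-swap = least-resp touches-swap touches-swap

  F⇒least : ∀ {u v} → F u v →
            H u v × ∃[ p ] ∃[ r ] LeastTouched R u v p r × R (u , v) (p , r)
  F⇒least {u} {v} = to (F⇔ u v)

  F⇒H : ∀ {u v} → F u v → H u v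
  F⇒H = proj₁ ∘ F⇒least

  F-resp : ∀ {u v x y} → R (u , v) (x , y) → F u v → F x y
  F-resp Rp Fuv with F⇒least Fuv
  ... | _ , p , r , l , Rpr = from (F⇔ _ _)
    ( R⇒H (R-sym Rp) , p , r
    , least-resp (touches-R (R-sym Rp)) (touches-R Rp) l , R-trans (R-sym Rp) Rpr)

  -- A class and its reverse touch the same pairs and so share the least one; if both contained it,
  -- the class would meet its reverse.
  F-asym : ∀ {u v} → F u v → ¬ F v u
  F-asym Fuv Fvu with F⇒least Fuv | F⇒least Fvu
  ... | _ , p , r , l , Rp | _ , p′ , r′ , l′ , Rp′ with least-unique l (least-swap l′)
  ... | refl = R-asym (R-trans Rp (R-sym Rp′))

  F-total : ∀ {u v} → H u v → F u v ⊎ F v u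
  F-total {u} {v} Huv with touched u v (R-refl Huv)
  ... | p , r , l with touches l
  ... | inj₁ Rpr = inj₁ (from (F⇔ _ _) (Huv , p , r , l , Rpr))
  ... | inj₂ Rrp = inj₂ (from (F⇔ _ _) (H-sym Huv , p , r , least-swap l , R-swap Rrp))

  -- `F` is a union of classes and asymmetric, so in a cyclic triangle the class of uv contains
  -- neither wv nor uw. Thus the triangle lemma applies with any vertex of the cycle as apex.
  F-triangle : ∀ {u v w p q} → F u v → F v w → F w u → R (u , v) (p , q) →
               R (w , u) (w , p) × R (w , v) (w , q)
  F-triangle Fuv Fvw Fwu Rp = triangle Rp
    ( F⇒H Fwu , H-sym (F⇒H Fvw)
    , (λ x → F-asym (F-resp x Fuv) Fvw) , λ x → F-asym (F-resp x Fuv) Fwu)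

  firstTouched : ∀ {u v} → F u v → Fin n
  firstTouched = proj₁ ∘ proj₂ ∘ F⇒least

  -- With uv moved to its least pair pq, wu moves to wp, so the class of wu touches p in reverse.
  first-≤ : ∀ {u v w} (Fuv : F u v) → F v w → (Fwu : F w u) →
            firstTouched Fwu Fin.≤ firstTouched Fuv
  first-≤ {w = w} Fuv Fvw Fwu with F⇒least Fuv | F⇒least Fwu
  ... | _ , p , _ , _ , Rpq | _ , p′ , _ , l′ , _ =
    ≮⇒≥ λ p<p′ → p-least l′ p<p′ w (inj₂ (proj₁ (F-triangle Fuv Fvw Fwu Rpq)))

  -- The classes of the three edges touch the same least vertex p, each by
  -- an edge that leaves p; by the triangle lemma this closes an edge upon
  -- its own reverse.
  no-cycle : ∀ {u v w} → F u v → F v w → ¬ F w u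
  no-cycle {u} {v} {w} Fuv Fvw Fwu =
    let _ , p , _ , _ , Rpq = F⇒least Fuv
        _ , _ , r , _ , Rpr = F⇒least Fwu
        Rwp , _ = F-triangle Fuv Fvw Fwu Rpq
        -- Moving wu to pr takes vw to vp; moving it to wp takes vu to vp. So vw and vu share a
        -- class, which puts vu into `F` beside uv.
        Rvp , _ = F-triangle Fwu Fuv Fvw (subst (λ p → R (w , u) (p , r)) same Rpr)
        _ , Rvp′ = F-triangle Fwu Fuv Fvw Rwp
    in F-asym Fuv (F-resp (R-trans Rvp (R-sym Rvp′)) Fvw)
    where
    same : firstTouched Fwu ≡ firstTouched Fuv
    same = Finₚ.≤-antisym (first-≤ Fuv Fvw Fwu)
      (Finₚ.≤-trans (first-≤ Fvw Fwu Fuv) (first-≤ Fwu Fuv Fvw))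

  F-orients : IsTransitiveOrientation H F
  F-orients = record { sound = F⇒H ; total = F-total ; P-trans = F-trans }
    where
    F-trans : Transitive F
    F-trans {u} {v} {w} Fuv Fvw with H? u w
    -- Without the edge uw, uv forces wv.
    ... | no ¬Huw  = contradiction Fvw
      (F-asym (F-resp (step (F⇒H Fuv , H-sym (F⇒H Fvw) , inj₂ (refl , ¬Huw))) Fuv))
    ... | yes Huw with F-total Huw
    ... | inj₁ Fuw = Fuw
    ... | inj₂ Fwu = contradiction Fwu (no-cycle Fuv Fvw)

-- Finite subsets and minimal elements

separate : ∀ {n} {P : Fin n → Set} → (∀ x → Dec (P x)) → Subset n
separate P? = Vec.tabulate (does ∘ P?)

∈-separate : ∀ {n} {P : Fin n → Set} (P? : ∀ x → Dec (P x)) x → x ∈ separate P? ⇔ P x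
∈-separate {P = P} P? x = mk⇔
  (λ x∈ → decided (trans (sym (lookup∘tabulate (does ∘ P?) x)) ([]=⇒lookup x∈)))
  (λ Px → lookup⇒[]= x _ (trans (lookup∘tabulate (does ∘ P?) x) (dec-true (P? x) Px)))
  where
  decided : does (P? x) ≡ true → P x
  decided eq with P? x
  ... | yes Px = Px

∣∪∣-disjoint : ∀ {n} (p q : Subset n) → (∀ {x} → x ∈ p → x ∉ q) → ∣ p ∪ q ∣ ≡ ∣ p ∣ + ∣ q ∣
∣∪∣-disjoint []          []          dis = refl
∣∪∣-disjoint (true  ∷ p) (true  ∷ q) dis = contradiction here (dis here)
∣∪∣-disjoint (true  ∷ p) (false ∷ q) dis =
  cong suc (∣∪∣-disjoint p q λ x y → dis (there x) (there y))
∣∪∣-disjoint (false ∷ p) (true  ∷ q) dis =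
  trans (cong suc (∣∪∣-disjoint p q λ x y → dis (there x) (there y))) (sym (+-suc ∣ p ∣ ∣ q ∣))
∣∪∣-disjoint (false ∷ p) (false ∷ q) dis =
  ∣∪∣-disjoint p q λ x y → dis (there x) (there y)

∣p∣≤∣q∣+∣p─q∣ : ∀ {n} (p q : Subset n) → ∣ p ∣ ≤ ∣ q ∣ + ∣ p ─ q ∣
∣p∣≤∣q∣+∣p─q∣ []          []          = z≤n
∣p∣≤∣q∣+∣p─q∣ (true  ∷ p) (true  ∷ q) = s≤s (∣p∣≤∣q∣+∣p─q∣ p q)
∣p∣≤∣q∣+∣p─q∣ (true  ∷ p) (false ∷ q) =
  ≤-trans (s≤s (∣p∣≤∣q∣+∣p─q∣ p q)) (≤-reflexive (sym (+-suc ∣ q ∣ _)))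
∣p∣≤∣q∣+∣p─q∣ (false ∷ p) (true  ∷ q) = m≤n⇒m≤1+n (∣p∣≤∣q∣+∣p─q∣ p q)
∣p∣≤∣q∣+∣p─q∣ (false ∷ p) (false ∷ q) = ∣p∣≤∣q∣+∣p─q∣ p q

∈─⇒∉ : ∀ {n} (p q : Subset n) {x} → x ∈ p ─ q → x ∉ q
∈─⇒∉ (_ ∷ p) (true ∷ q)  ()        here
∈─⇒∉ (_ ∷ p) (true ∷ q)  (there x) (there y) = ∈─⇒∉ p q x y
∈─⇒∉ (_ ∷ p) (false ∷ q) (there x) (there y) = ∈─⇒∉ p q x y

subset-of-size : ∀ {n} (p : Subset n) i → i ≤ ∣ p ∣ → ∃[ q ] q ⊆ p × ∣ q ∣ ≡ i
subset-of-size []          zero    _         = [] , id , refl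
subset-of-size (false ∷ p) i       i≤        with subset-of-size p i i≤
... | q , q⊆p , eq = false ∷ q , out⊆ q⊆p , eq
subset-of-size (true ∷ p)  zero    _         with subset-of-size p 0 z≤n
... | q , q⊆p , eq = false ∷ q , out⊆ q⊆p , eq
subset-of-size (true ∷ p)  (suc i) (s≤s i≤) with subset-of-size p i i≤
... | q , q⊆p , eq = true ∷ q , in⊆in q⊆p , cong suc eq

minimal : ∀ {n} {_⊏_ : Rel (Fin n)} → (∀ u v → Dec (u ⊏ v)) → Transitive _⊏_ →
          (∀ {u} → ¬ u ⊏ u) → (D : Subset n) → Nonempty D →
          ∃[ m ] m ∈ D × (∀ {d} → d ∈ D → ¬ d ⊏ m)
minimal {_⊏_ = _⊏_} _⊏?_ ⊏-trans ⊏-irrefl D (x , x∈D) = go x x∈D (spo-wellFounded isSPO x)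
  where
  isSPO : IsStrictPartialOrder _≡_ _⊏_
  isSPO = record
    { isEquivalence = isEquivalence ; irrefl = λ { refl → ⊏-irrefl } ; trans = ⊏-trans
    ; <-resp-≈ = (λ { refl → id }) , (λ { refl → id }) }
  go : ∀ x → x ∈ D → Acc _⊏_ x → ∃[ m ] m ∈ D × (∀ {d} → d ∈ D → ¬ d ⊏ m)
  go x x∈D (acc rs) with any? (λ d → d ∈? D ×-dec d ⊏? x)
  ... | yes (d , d∈D , d⊏x) = go d d∈D (rs d⊏x)
  ... | no none             = x , x∈D , λ d∈D d⊏x → none (_ , d∈D , d⊏x)

-- Two-dimensional orders and the block decomposition of colorings

record TwoDimensional {n} (F Q : Rel (Fin n)) : Set where
  field
    F?        : ∀ u v → Dec (F u v)
    Q?        : ∀ u v → Dec (Q u v)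
    F-trans   : Transitive F
    Q-trans   : Transitive Q
    F-irrefl  : ∀ {u} → ¬ F u u
    Q-irrefl  : ∀ {u} → ¬ Q u u
    exclusive : ∀ {u v} → F u v → ¬ (Q u v ⊎ Q v u)
    trichot   : ∀ u v → u ≡ v ⊎ (F u v ⊎ F v u) ⊎ (Q u v ⊎ Q v u)

-- `Q` is a conjugate order in the sense of Dushnik and Miller. Reversing it makes one construction
-- yield both linear extensions of `F`.
reverse : ∀ {n} {F Q : Rel (Fin n)} → TwoDimensional F Q → TwoDimensional F (flip Q)
reverse D = record
  { F? = F? ; Q? = flip Q? ; F-trans = F-trans ; Q-trans = flip Q-trans
  ; F-irrefl = F-irrefl ; Q-irrefl = Q-irrefl ; exclusive = λ f → exclusive f ∘ [ inj₂ , inj₁ ]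
  ; trichot = λ u v → [ inj₁ , inj₂ ∘ [ inj₁ , inj₂ ∘ [ inj₂ , inj₁ ] ] ] (trichot u v)
  } where open TwoDimensional D

module Realizer {n} {F Q : Rel (Fin n)} (D : TwoDimensional F Q) where
  open TwoDimensional D

  L : Rel (Fin n)
  L u v = F u v ⊎ Q u v

  -- In a mixed composition, any wrong relation between the ends composes with one of the two steps
  -- and makes some pair comparable in both `F` and `Q`.
  L-trans : Transitive L
  L-trans (inj₁ f) (inj₁ g) = inj₁ (F-trans f g)
  L-trans (inj₂ f) (inj₂ g) = inj₂ (Q-trans f g)
  L-trans {u} {v} {w} (inj₁ f) (inj₂ g) with trichot u w
  ... | inj₁ refl                 = contradiction (inj₂ g) (exclusive f)
  ... | inj₂ (inj₁ (inj₁ Fuw))    = inj₁ Fuw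
  ... | inj₂ (inj₁ (inj₂ Fwu))    = contradiction (inj₂ g) (exclusive (F-trans Fwu f))
  ... | inj₂ (inj₂ (inj₁ Quw))    = inj₂ Quw
  ... | inj₂ (inj₂ (inj₂ Qwu))    = contradiction (inj₂ (Q-trans g Qwu)) (exclusive f)
  L-trans {u} {v} {w} (inj₂ f) (inj₁ g) with trichot u w
  ... | inj₁ refl                 = contradiction (inj₂ f) (exclusive g)
  ... | inj₂ (inj₁ (inj₁ Fuw))    = inj₁ Fuw
  ... | inj₂ (inj₁ (inj₂ Fwu))    = contradiction (inj₂ f) (exclusive (F-trans g Fwu))
  ... | inj₂ (inj₂ (inj₁ Quw))    = inj₂ Quw
  ... | inj₂ (inj₂ (inj₂ Qwu))    = contradiction (inj₂ (Q-trans Qwu f)) (exclusive g)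

  maximum : (D : Subset n) → Nonempty D → ∃[ m ] m ∈ D × (∀ {d} → d ∈ D → d ≡ m ⊎ L d m)
  maximum D ne with minimal {_⊏_ = flip L} (λ u v → F? v u ⊎-dec Q? v u)
                      (flip L-trans) [ F-irrefl , Q-irrefl ] D ne
  ... | m , m∈D , max = m , m∈D , λ {d} d∈D → below-m d∈D (trichot d m)
    where
    below-m : ∀ {d} → d ∈ D → _ → d ≡ m ⊎ L d m
    below-m d∈D (inj₁ eq)                = inj₁ eq
    below-m d∈D (inj₂ (inj₁ (inj₁ Fdm))) = inj₂ (inj₁ Fdm)
    below-m d∈D (inj₂ (inj₁ (inj₂ Fmd))) = contradiction (inj₁ Fmd) (max d∈D)
    below-m d∈D (inj₂ (inj₂ (inj₁ Qdm))) = inj₂ (inj₂ Qdm)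
    below-m d∈D (inj₂ (inj₂ (inj₂ Qmd))) = contradiction (inj₂ Qmd) (max d∈D)

module Colorings {n} {F Q : Rel (Fin n)} (D : TwoDimensional F Q) where
  open TwoDimensional D

  -- u and v are the last elements of D in the two linear extensions
  -- F ∪ Q and F ∪ Q⁻¹, whose intersection is F.
  dominated : (D : Subset n) → Nonempty D →
    ∃[ u ] ∃[ v ] u ∈ D × v ∈ D × (∀ {x d} → F u x → F v x → d ∈ D → F d x)
  dominated D₁ ne with Realizer.maximum D D₁ ne | Realizer.maximum (reverse D) D₁ ne
  ... | u , u∈D , u-max | v , v∈D , v-max = u , v , u∈D , v∈D , λ {x} {d} → dominates {x} {d}
    where
    dominates : ∀ {x d} → F u x → F v x → d ∈ D₁ → F d x
    dominates Fux Fvx d∈D with u-max d∈D | v-max d∈D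
    ... | inj₁ refl | _         = Fux
    ... | inj₂ _    | inj₁ refl = Fvx
    -- `d` precedes `x` in both extensions. If neither gave `F d x`, the first would give `Q d x`
    -- and the second `Q x d`.
    ... | inj₂ d⊏u  | inj₂ d⊏v
      with Realizer.L-trans D d⊏u (inj₁ Fux) | Realizer.L-trans (reverse D) d⊏v (inj₁ Fvx)
    ... | inj₁ Fdx | _        = Fdx
    ... | inj₂ _   | inj₁ Fdx = Fdx
    ... | inj₂ Qdx | inj₂ Qxd = contradiction (Q-trans Qdx Qxd) Q-irrefl

  Above : Fin n → Fin n → Fin n → Set
  Above u v x = F u x × F v x

  -- Comparability in `F` stands for being distinct and nonadjacent, so it also makes the two colors
  -- disjoint.
  record Coloring (S : Subset n) (i j : ℕ) : Set where
    constructor coloring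
    field
      {black white} : Subset n
      black⊆     : black ⊆ S
      white⊆     : white ⊆ S
      comparable : ∀ {x y} → x ∈ black → y ∈ white → F x y ⊎ F y x
      black≥     : i ≤ ∣ black ∣
      white≥     : j ≤ ∣ white ∣

  flipColors : ∀ {S i j} → Coloring S i j → Coloring S j i
  flipColors (coloring b w c x y) = coloring w b (λ p q → [ inj₂ , inj₁ ] (c q p)) y x

  module Dynamic
    (above : Fin n → Fin n → Subset n) (∈above : ∀ {u v x} → x ∈ above u v ⇔ Above u v x)
    (block : Subset n → Fin n → Fin n → Subset n)
    (∈block : ∀ {S u v x} → x ∈ block S u v ⇔ (x ∈ S × (∀ y → Above u v y → F x y)))
    where

    -- One color receives the whole block, and the rest is colored above `u` and `v`. Truncated
    -- subtraction lets a block exceed the demand. If `u` and `v` have no common upper bound, the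
    -- block is all of `S`.
    Best : (Fin n → Fin n → ℕ → ℕ → Set) → Subset n → ℕ → ℕ → Set
    Best T S i j = (i ≡ 0 × j ≡ 0) ⊎ ∃[ u ] ∃[ v ] u ∈ S × v ∈ S
      × (T u v (i ∸ ∣ block S u v ∣) j ⊎ T u v i (j ∸ ∣ block S u v ∣))

    -- `Best (Table k)` allows at most `k` blocks: `Table zero` is empty, but `Best` itself accepts
    -- the demand of no vertices.
    Table : ℕ → Fin n → Fin n → ℕ → ℕ → Set
    Table zero    u v i j = ⊥
    Table (suc k) u v i j = Best (Table k) (above u v) i j

    UpClosed : Subset n → Set
    UpClosed S = ∀ {x y} → x ∈ S → F x y → y ∈ S

    above-upClosed : ∀ u v → UpClosed (above u v)
    above-upClosed u v x∈ Fxy = let Fux , Fvx = to ∈above x∈ in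
      from ∈above (F-trans Fux Fxy , F-trans Fvx Fxy)

    -- The block lies below every common upper bound of `u` and `v`, hence below all that is colored
    -- already; by irreflexivity the union is disjoint.
    addBlock : ∀ {S u v i j} → UpClosed S → u ∈ S → v ∈ S →
               Coloring (above u v) (i ∸ ∣ block S u v ∣) j → Coloring S i j
    addBlock {S} {u} {v} {i} up u∈S v∈S (coloring {B} {W} B⊆ W⊆ cmp B≥ W≥) = coloring
      {black = block S u v ∪ B}
      (λ x∈ → [ proj₁ ∘ to ∈block , inside ∘ B⊆ ] (x∈p∪q⁻ (block S u v) B x∈))
      (inside ∘ W⊆)
      (λ x∈ y∈ → [ (λ x∈D → inj₁ (proj₂ (to ∈block x∈D) _ (to ∈above (W⊆ y∈))))
                 , (λ x∈B → cmp x∈B y∈) ] (x∈p∪q⁻ (block S u v) B x∈))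
      (begin
        i                                          ≤⟨ m≤n+m∸n i ∣ block S u v ∣ ⟩
        ∣ block S u v ∣ + (i ∸ ∣ block S u v ∣)    ≤⟨ +-monoʳ-≤ ∣ block S u v ∣ B≥ ⟩
        ∣ block S u v ∣ + ∣ B ∣                    ≡⟨ ∣∪∣-disjoint (block S u v) B
          (λ x∈D x∈B → F-irrefl (proj₂ (to ∈block x∈D) _ (to ∈above (B⊆ x∈B)))) ⟨
        ∣ block S u v ∪ B ∣                        ∎)
      W≥
      where
      open ≤-Reasoning
      inside : ∀ {x} → x ∈ above u v → x ∈ S
      inside x∈ = up u∈S (proj₁ (to ∈above x∈))

    Best-sound : ∀ {T S i j} → UpClosed S →
      (∀ {u v i j} → T u v i j → Coloring (above u v) i j) → Best T S i j → Coloring S i j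
    Best-sound up T-sound (inj₁ (refl , refl)) =
      coloring {black = Vec.replicate n false} {Vec.replicate n false}
        ⊥⊆ ⊥⊆ (λ x∈ → contradiction x∈ ∉⊥) z≤n z≤n
    Best-sound up T-sound (inj₂ (u , v , u∈S , v∈S , inj₁ t)) =
      addBlock up u∈S v∈S (T-sound t)
    Best-sound up T-sound (inj₂ (u , v , u∈S , v∈S , inj₂ t)) =
      flipColors (addBlock up u∈S v∈S (flipColors (T-sound t)))

    Table-sound : ∀ k {u v i j} → Table k u v i j → Coloring (above u v) i j
    Table-sound (suc k) = Best-sound (above-upClosed _ _) (Table-sound k)

    colored : ∀ {S i j} → Coloring S i j → ℕ
    colored c = ∣ Coloring.black c ∣ + ∣ Coloring.white c ∣

    -- The black elements below all white ones lie below everything else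
    -- that is colored: any other black one is above some white one.
    removeBlock : ∀ {S i j x} (c : Coloring S i j) → x ∈ Coloring.black c →
      (∀ {y} → y ∈ Coloring.white c → ¬ F y x) →
      ∃[ u ] ∃[ v ] u ∈ S × v ∈ S × ∃[ c′ ]
        (colored {above u v} {i ∸ ∣ block S u v ∣} {j} c′ < colored c)
    removeBlock {S} {i} {j} {x} (coloring {B} {W} B⊆ W⊆ cmp B≥ W≥) x∈B x-minimal =
      -- Two members represent `D₁`: the block computed from them contains `D₁` and may exceed it,
      -- which only lowers the remaining demand.
      let u , v , u∈D , v∈D , dom = dominated D₁ (x , x∈D)
          D⊆block : D₁ ⊆ block S u v
          D⊆block d∈ = from ∈block (B⊆ (D⊆B d∈) , λ y (Fuy , Fvy) → dom Fuy Fvy d∈)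
      in u , v , B⊆ (D⊆B u∈D) , B⊆ (D⊆B v∈D) ,
         coloring {black = B ─ D₁} {W}
           (λ b∈ → from ∈above (D<rest u∈D b∈ , D<rest v∈D b∈))
           (λ w∈ → from ∈above (D<W u∈D w∈ , D<W v∈D w∈))
           (λ b∈ → cmp (p─q⊆p B D₁ b∈))
           (m≤n+o⇒m∸n≤o i ∣ block S u v ∣ (≤-trans B≥ (≤-trans (∣p∣≤∣q∣+∣p─q∣ B D₁)
             (+-monoˡ-≤ ∣ B ─ D₁ ∣ (p⊆q⇒∣p∣≤∣q∣ D⊆block)))))
           W≥
         , +-monoˡ-< ∣ W ∣ (p∩q≢∅⇒∣p─q∣<∣p∣ B D₁ (x , x∈p∩q⁺ (x∈B , x∈D)))
      where
      below-white? : ∀ b → Dec (∀ w → w ∈ W → F b w)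
      below-white? b = all? (λ w → w ∈? W →-dec F? b w)
      first D₁ : Subset n
      first = separate below-white?
      D₁ = B ∩ first
      x∈D : x ∈ D₁
      x∈D = x∈p∩q⁺ (x∈B , from (∈-separate below-white? x) λ w w∈W →
        [ id , (λ Fwx → contradiction Fwx (x-minimal w∈W)) ] (cmp x∈B w∈W))
      D⊆B : ∀ {d} → d ∈ D₁ → d ∈ B
      D⊆B = p∩q⊆p B first
      D<W : ∀ {d w} → d ∈ D₁ → w ∈ W → F d w
      D<W {d} d∈ = to (∈-separate below-white? d) (p∩q⊆q B first d∈) _
      D<rest : ∀ {d b} → d ∈ D₁ → b ∈ B ─ D₁ → F d b
      D<rest {d} {b} d∈ b∈ with below-white? b
      ... | yes b-first = contradiction
              (x∈p∩q⁺ (p─q⊆p B D₁ b∈ , from (∈-separate below-white? b) b-first))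
              (∈─⇒∉ B D₁ b∈)
      ... | no ¬b-first with ¬∀⟶∃¬ n _ (λ w → w ∈? W →-dec F? b w) ¬b-first
      ... | w , ¬Fbw with w ∈? W
      ... | no w∉W  = contradiction (λ w∈W → contradiction w∈W w∉W) ¬Fbw
      ... | yes w∈W with cmp (p─q⊆p B D₁ b∈) w∈W
      ... | inj₁ Fbw = contradiction (λ _ → Fbw) ¬Fbw
      ... | inj₂ Fwb = F-trans (D<W d∈ w∈W) Fwb

    -- Induction on the number of colored vertices. The color of a minimal colored vertex is the one
    -- whose block can be split off, and that block takes at least this vertex away.
    Best-complete : ∀ k {S i j} (c : Coloring S i j) → colored c ≤ k → Best (Table k) S i j
    Best-complete k {S} {i} {j} c@(coloring {B} {W} B⊆ W⊆ cmp B≥ W≥) c≤k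
      with nonempty? (B ∪ W)
    ... | no empty = inj₁
      ( n≤0⇒n≡0 (≤-trans B≥ (≤-trans (∣p∣≤∣p∪q∣ B W) ∣∪∣≤0))
      , n≤0⇒n≡0 (≤-trans W≥ (≤-trans (∣q∣≤∣p∪q∣ B W) ∣∪∣≤0)))
      where
      ∣∪∣≤0 : ∣ B ∪ W ∣ ≤ 0
      ∣∪∣≤0 = ≤-reflexive (trans (cong ∣_∣ (Empty-unique empty)) (∣⊥∣≡0 n))
    ... | yes ne with minimal F? F-trans F-irrefl (B ∪ W) ne
    ... | x , x∈ , x-minimal = step k c≤k (x∈p∪q⁻ B W x∈)
      where
      step : ∀ k → colored c ≤ k → x ∈ B ⊎ x ∈ W → Best (Table k) S i j
      step k c≤k (inj₁ x∈B)
        with removeBlock c x∈B (x-minimal ∘ q⊆p∪q B W)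
      ... | u , v , u∈S , v∈S , c′ , c′<c with k | <-≤-trans c′<c c≤k
      ... | suc k′ | s≤s c′≤k′ = inj₂ (u , v , u∈S , v∈S , inj₁ (Best-complete k′ c′ c′≤k′))
      step k c≤k (inj₂ x∈W)
        with removeBlock (flipColors c) x∈W (x-minimal ∘ p⊆p∪q W)
      ... | u , v , u∈S , v∈S , c′ , c′<c
        with k | <-≤-trans c′<c (≤-trans (≤-reflexive (+-comm ∣ W ∣ ∣ B ∣)) c≤k)
      ... | suc k′ | s≤s c′≤k′ = inj₂ (u , v , u∈S , v∈S , inj₂
        (Best-complete k′ (flipColors c′)
          (≤-trans (≤-reflexive (+-comm ∣ Coloring.white c′ ∣ _)) c′≤k′)))

-- Permutation diagrams

p<q⇒0<q-p : ∀ {p q} → p ℚ.< q → 0ℚ ℚ.< q ℚ.- p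
p<q⇒0<q-p {p} {q} p<q =
  subst (ℚ._< q ℚ.- p) (ℚ.+-inverseʳ p) (ℚ.+-monoˡ-< (ℚ.- p) p<q)

convex-< : ∀ {y s s′ t t′} → 0ℚ ℚ.≤ y → y ℚ.≤ 1ℚ → s ℚ.< s′ → t ℚ.< t′ →
           y ℚ.* s ℚ.+ (1ℚ ℚ.- y) ℚ.* t ℚ.< y ℚ.* s′ ℚ.+ (1ℚ ℚ.- y) ℚ.* t′
convex-< {y} {s} {s′} {t} {t′} 0≤y y≤1 s<s′ t<t′ with ℚ.<-cmp 0ℚ y
... | tri> _ _ y<0 = contradiction refl (ℚ.<⇒≢ (ℚ.≤-<-trans 0≤y y<0))
-- At height 0 the top coordinates have weight zero, and strictness comes from the bottom ones.
... | tri≈ _ refl _ = subst₂ ℚ._<_ (at-0 s t) (at-0 s′ t′) t<t′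
  where
  open +-*-Solver
  at-0 : ∀ s t → t ≡ 0ℚ ℚ.* s ℚ.+ (1ℚ ℚ.- 0ℚ) ℚ.* t
  at-0 = solve 2 (λ s t → t := con 0ℚ :* s :+ (con 1ℚ :- con 0ℚ) :* t) refl
... | tri< 0<y _ _ = ℚ.+-mono-<-≤
  (ℚ.*-monoʳ-<-pos y {{ℚ.positive 0<y}} s<s′)
  (ℚ.*-monoˡ-≤-nonNeg (1ℚ ℚ.- y) {{ℚ.nonNegative 0≤1-y}} (ℚ.<⇒≤ t<t′))
  where
  0≤1-y : 0ℚ ℚ.≤ 1ℚ ℚ.- y
  0≤1-y = subst (ℚ._≤ 1ℚ ℚ.- y) (ℚ.+-inverseʳ y) (ℚ.+-monoˡ-≤ (ℚ.- y) y≤1)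

-- The point that divides the unit interval in the ratio q to p.
balance : ∀ p q .{{_ : ℚ.Positive p}} .{{_ : ℚ.Positive q}} →
  ∃[ y ] 0ℚ ℚ.≤ y × y ℚ.≤ 1ℚ × y ℚ.* p ≡ (1ℚ ℚ.- y) ℚ.* q
balance p q = divide (1/ (p ℚ.+ q)) (ℚ.*-inverseʳ (p ℚ.+ q)) {{ℚ.1/pos⇒pos (p ℚ.+ q)}}
  where
  instance
    p+q>0 = ℚ.pos+pos⇒pos p q
    p+q≢0 = ℚ.pos⇒nonZero (p ℚ.+ q)
  divide : ∀ d → (p ℚ.+ q) ℚ.* d ≡ 1ℚ → .{{_ : ℚ.Positive d}} →
    ∃[ y ] 0ℚ ℚ.≤ y × y ℚ.≤ 1ℚ × y ℚ.* p ≡ (1ℚ ℚ.- y) ℚ.* q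
  -- As `d` is the inverse of p + q, the witness is q / (p + q).
  divide d eq = q ℚ.* d
    , ℚ.<⇒≤ (ℚ.positive⁻¹ (q ℚ.* d) {{ℚ.pos*pos⇒pos q d}})
    , subst₂ ℚ._≤_ (ℚ.+-identityˡ (q ℚ.* d)) pd+qd≡1 (ℚ.+-monoˡ-≤ (q ℚ.* d)
        (ℚ.<⇒≤ (ℚ.positive⁻¹ (p ℚ.* d) {{ℚ.pos*pos⇒pos p d}})))
    , trans (solve 3 (λ p q d → q :* d :* p := p :* d :* q) refl p q d)
        (cong (ℚ._* q) (sym 1-qd≡pd))
    where
    open +-*-Solver
    pd+qd≡1 : p ℚ.* d ℚ.+ q ℚ.* d ≡ 1ℚ
    pd+qd≡1 = trans (sym (ℚ.*-distribʳ-+ d p q)) eq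
    1-qd≡pd : 1ℚ ℚ.- q ℚ.* d ≡ p ℚ.* d
    1-qd≡pd = trans (cong (ℚ._- q ℚ.* d) (sym pd+qd≡1))
      (solve 2 (λ a b → a :+ b :- b := a) refl (p ℚ.* d) (q ℚ.* d))

meet : ∀ y z s s′ t t′ → y ℚ.* (s′ ℚ.- s) ≡ z ℚ.* (t ℚ.- t′) →
       y ℚ.* s ℚ.+ z ℚ.* t ≡ y ℚ.* s′ ℚ.+ z ℚ.* t′
meet y z s s′ t t′ eq = begin
  y ℚ.* s ℚ.+ z ℚ.* t                                ≡⟨ cong (y ℚ.* s ℚ.+_) (shift z t′ t) ⟩
  y ℚ.* s ℚ.+ (z ℚ.* (t ℚ.- t′) ℚ.+ z ℚ.* t′)        ≡⟨ ℚ.+-assoc (y ℚ.* s) _ _ ⟨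
  y ℚ.* s ℚ.+ z ℚ.* (t ℚ.- t′) ℚ.+ z ℚ.* t′          ≡⟨ cong (ℚ._+ z ℚ.* t′) (begin
    y ℚ.* s ℚ.+ z ℚ.* (t ℚ.- t′)                       ≡⟨ cong (y ℚ.* s ℚ.+_) eq ⟨
    y ℚ.* s ℚ.+ y ℚ.* (s′ ℚ.- s)                       ≡⟨ ℚ.+-comm (y ℚ.* s) _ ⟩
    y ℚ.* (s′ ℚ.- s) ℚ.+ y ℚ.* s                       ≡⟨ shift y s s′ ⟨
    y ℚ.* s′                                           ∎) ⟩
  y ℚ.* s′ ℚ.+ z ℚ.* t′                              ∎
  where
  open ≡-Reasoning
  open +-*-Solver
  shift : ∀ y s s′ → y ℚ.* s′ ≡ y ℚ.* (s′ ℚ.- s) ℚ.+ y ℚ.* s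
  shift = solve 3 (λ y s s′ → y :* s′ := y :* (s′ :- s) :+ y :* s) refl

module _ {n} (D : PermutationDiagram n) where
  open PermutationDiagram D

  intersect⇒¬parallel : ∀ {k l} → SegmentsIntersect k l →
                        ¬ (top k ℚ.< top l × bottom k ℚ.< bottom l)
  intersect⇒¬parallel (x , y , (0≤y , y≤1 , eq) , (_ , _ , eq′)) (t< , b<) =
    ℚ.<⇒≢ (convex-< 0≤y y≤1 t< b<) (trans (sym eq) eq′)

  -- The horizontal gaps on the two lines have opposite signs and cancel at the height that balances
  -- them.
  crossing⇒intersect : ∀ {k l} → top k ℚ.< top l → bottom l ℚ.< bottom k → SegmentsIntersect k l
  crossing⇒intersect {k} {l} t< b< = segments (balance (top l ℚ.- top k) (bottom k ℚ.- bottom l)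
      {{ℚ.positive (p<q⇒0<q-p t<)}} {{ℚ.positive (p<q⇒0<q-p b<)}})
    where
    segments : ∃[ y ] 0ℚ ℚ.≤ y × y ℚ.≤ 1ℚ
                 × y ℚ.* (top l ℚ.- top k) ≡ (1ℚ ℚ.- y) ℚ.* (bottom k ℚ.- bottom l) →
               SegmentsIntersect k l
    segments (y , 0≤y , y≤1 , eq) = y ℚ.* top k ℚ.+ (1ℚ ℚ.- y) ℚ.* bottom k , y
      , (0≤y , y≤1 , refl)
      , (0≤y , y≤1 , meet y (1ℚ ℚ.- y) (top k) (top l) (bottom k) (bottom l) eq)

Adj-sym : ∀ {n} (G : Graph n) {u v} → Graph.Adj G u v → Graph.Adj G v u
Adj-sym G {u} {v} = subst T (Graph.symm G u v)

module PermutationGraph {n} (G : Graph n) (D : PermutationDiagram n) (σ : Permutation′ n)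
  (adj⇔ : ∀ u v → Graph.Adj G u v
                  ⇔ PermutationDiagram.DiagramAdj D (σ ⟨$⟩ʳ u) (σ ⟨$⟩ʳ v)) where
  open Graph G
  open PermutationDiagram D

  private
    t b : Fin n → ℚ
    t u = top (σ ⟨$⟩ʳ u)
    b u = bottom (σ ⟨$⟩ʳ u)

  LeftOf Crosses : Rel (Fin n)
  LeftOf  u v = t u ℚ.< t v × b u ℚ.< b v
  Crosses u v = t u ℚ.< t v × b v ℚ.< b u

  Crosses? : ∀ u v → Dec (Crosses u v)
  Crosses? u v = t u ℚ.<? t v ×-dec b v ℚ.<? b u

  σ-≢ : ∀ {u v} → u ≢ v → σ ⟨$⟩ʳ u ≢ σ ⟨$⟩ʳ v
  σ-≢ u≢v = u≢v ∘ Injection.injective (↔⇒↣ σ)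

  <-total : ∀ (f : Fin n → ℚ) → (∀ {k l} → f k ≡ f l → k ≡ l) → ∀ {u v} → u ≢ v →
            f (σ ⟨$⟩ʳ u) ℚ.< f (σ ⟨$⟩ʳ v) ⊎ f (σ ⟨$⟩ʳ v) ℚ.< f (σ ⟨$⟩ʳ u)
  <-total f f-inj {u} {v} u≢v with ℚ.<-cmp (f (σ ⟨$⟩ʳ u)) (f (σ ⟨$⟩ʳ v))
  ... | tri< lt _ _ = inj₁ lt
  ... | tri≈ _ eq _ = contradiction (f-inj eq) (σ-≢ u≢v)
  ... | tri> _ _ gt = inj₂ gt

  classify : ∀ {u v} → u ≢ v →
             (LeftOf u v ⊎ LeftOf v u) ⊎ (Crosses u v ⊎ Crosses v u)
  classify u≢v with <-total top top-distinct u≢v | <-total bottom bottom-distinct u≢v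
  ... | inj₁ t< | inj₁ b< = inj₁ (inj₁ (t< , b<))
  ... | inj₁ t< | inj₂ b> = inj₂ (inj₁ (t< , b>))
  ... | inj₂ t> | inj₁ b< = inj₂ (inj₂ (t> , b<))
  ... | inj₂ t> | inj₂ b> = inj₁ (inj₂ (t> , b>))

  <⇒≢ᵛ : ∀ {u v} → t u ℚ.< t v → u ≢ v
  <⇒≢ᵛ t< refl = ℚ.<-irrefl refl t<

  leftOf⇒¬Adj : ∀ {u v} → LeftOf u v → ¬ Adj u v
  leftOf⇒¬Adj l a = intersect⇒¬parallel D (proj₂ (to (adj⇔ _ _) a)) l

  crosses⇒Adj : ∀ {u v} → Crosses u v → Adj u v
  crosses⇒Adj (t< , b>) =
    from (adj⇔ _ _) (σ-≢ (<⇒≢ᵛ t<) , crossing⇒intersect D t< b>)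

  leftOf-orients : IsTransitiveOrientation (λ u v → ¬ Adj u v × u ≢ v) LeftOf
  leftOf-orients = record
    { sound   = λ l → leftOf⇒¬Adj l , <⇒≢ᵛ (proj₁ l)
    ; total   = λ (¬a , u≢v) → [ id , [ (λ c → contradiction (crosses⇒Adj c) ¬a)
                , (λ c → contradiction (Adj-sym G (crosses⇒Adj c)) ¬a) ] ] (classify u≢v)
    ; P-trans = λ (t< , b<) (t<′ , b<′) → ℚ.<-trans t< t<′ , ℚ.<-trans b< b<′
    }

  crosses-orients : IsTransitiveOrientation Adj Crosses
  crosses-orients = record
    { sound   = crosses⇒Adj
    ; total   = λ {u} {v} a → [ [ (λ l → contradiction a (leftOf⇒¬Adj l))
                      , (λ l → contradiction (Adj-sym G a) (leftOf⇒¬Adj l)) ] , id ]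
                    (classify (λ { refl → proj₁ (to (adj⇔ u u) a) refl }))
    ; P-trans = λ (t< , b>) (t<′ , b>′) → ℚ.<-trans t< t<′ , ℚ.<-trans b>′ b>
    }

-- Orienting the complement

v0 : ∀ {Γ A} → Term (A ∷ Γ) A
v0 = ref zero
v1 : ∀ {Γ A B} → Term (B ∷ A ∷ Γ) A
v1 = ref (suc zero)
v2 : ∀ {Γ A B C} → Term (C ∷ B ∷ A ∷ Γ) A
v2 = ref (suc (suc zero))
v3 : ∀ {Γ A B C D} → Term (D ∷ C ∷ B ∷ A ∷ Γ) A
v3 = ref (suc (suc (suc zero)))
v4 : ∀ {Γ A B C D E} → Term (E ∷ D ∷ C ∷ B ∷ A ∷ Γ) A
v4 = ref (suc (suc (suc (suc zero))))
v5 : ∀ {Γ A B C D E F} → Term (F ∷ E ∷ D ∷ C ∷ B ∷ A ∷ Γ) A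
v5 = ref (suc (suc (suc (suc (suc zero)))))
v6 : ∀ {Γ A B C D E F G} → Term (G ∷ F ∷ E ∷ D ∷ C ∷ B ∷ A ∷ Γ) A
v6 = ref (suc (suc (suc (suc (suc (suc zero))))))
v7 : ∀ {Γ A B C D E F G H} → Term (H ∷ G ∷ F ∷ E ∷ D ∷ C ∷ B ∷ A ∷ Γ) A
v7 = ref (suc (suc (suc (suc (suc (suc (suc zero)))))))

-- An environment of values such as numbers or digits does not determine `n`, so it is given
-- explicitly.
⟦_⟧[_] : ∀ {Γ A} → Term Γ A → ∀ n → Env n Γ → ⟦ A ⟧ᵗ n
⟦ t ⟧[ n ] γ = ⟦ t ⟧ γ

andᵗ orᵗ : ∀ {Γ} → Term Γ bool → Term Γ bool → Term Γ bool
andᵗ t u = ite bool t u (const ff)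
orᵗ  t u = ite bool t (const tt) u

notᵗ : ∀ {Γ} → Term Γ bool → Term Γ bool
notᵗ t = ite bool t (const ff) (const tt)

existsᵗ allᵗ : ∀ {Γ} e → Term (fin e ∷ Γ) bool → Term Γ bool
existsᵗ e t = fold e (const ff) (ite bool (wk t) (const tt) v0)
allᵗ    e t = fold e (const tt) (ite bool (wk t) v0 (const ff))

infixl 9 _!_

_!_ : ∀ {Γ e A} → Term Γ (vec e A) → Term Γ (fin e) → Term Γ A
_!_ = lookup

-- Logical reading of Boolean terms and loops

via : ∀ {p q} {P : Set} → p ≡ q → q ≡ true ⇔ P → p ≡ true ⇔ P
via refl e = e

and-⇔ : ∀ {p q} {P Q : Set} → p ≡ true ⇔ P → q ≡ true ⇔ Q → cond p q false ≡ true ⇔ (P × Q)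
and-⇔ {true}  e f = mk⇔ (λ t → to e refl , to f t) (λ (_ , y) → from f y)
and-⇔ {false} e f = mk⇔ (λ ()) (λ (x , _) → contradiction (from e x) λ ())

or-⇔ : ∀ {p q} {P Q : Set} → p ≡ true ⇔ P → q ≡ true ⇔ Q → cond p true q ≡ true ⇔ (P ⊎ Q)
or-⇔ {true}  e f = mk⇔ (λ _ → inj₁ (to e refl)) (λ _ → refl)
or-⇔ {false} e f = mk⇔ (λ t → inj₂ (to f t))
  [ (λ x → contradiction (from e x) λ ()) , from f ]

not-⇔ : ∀ {p} {P : Set} → p ≡ true ⇔ P → cond p false true ≡ true ⇔ (¬ P)
not-⇔ {true}  e = mk⇔ (λ ()) (λ ¬x → contradiction (to e refl) ¬x)
not-⇔ {false} e = mk⇔ (λ _ x → contradiction (from e x) λ ()) (λ _ → refl)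

exists-⇔ : ∀ m {p : Fin m → Bool} {P : Fin m → Set} → (∀ i → p i ≡ true ⇔ P i) →
           iterate m (λ i a → cond (p i) true a) false ≡ true ⇔ (∃[ i ] P i)
exists-⇔ zero    e = mk⇔ (λ ()) (λ ())
exists-⇔ (suc m) {p} {P} e = via (iterate-suc m (λ i a → cond (p i) true a) false) (mk⇔
  (λ t → [ (zero ,_) , (λ (i , x) → suc i , x) ] (to rest t))
  (λ { (zero , x) → from rest (inj₁ x) ; (suc i , x) → from rest (inj₂ (i , x)) }))
  where rest = or-⇔ (e zero) (exists-⇔ m {p ∘ suc} {P ∘ suc} (e ∘ suc))

all-⇔ : ∀ m {p : Fin m → Bool} {P : Fin m → Set} → (∀ i → p i ≡ true ⇔ P i) →
        iterate m (λ i a → cond (p i) a false) true ≡ true ⇔ (∀ i → P i)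
all-⇔ zero    e = mk⇔ (λ _ ()) (λ _ → refl)
all-⇔ (suc m) {p} {P} e = via (iterate-suc m (λ i a → cond (p i) a false) true) (mk⇔
  (λ t → λ { zero → proj₁ (to rest t) ; (suc i) → proj₂ (to rest t) i })
  (λ x → from rest (x zero , x ∘ suc)))
  where rest = and-⇔ (e zero) (all-⇔ m {p ∘ suc} {P ∘ suc} (e ∘ suc))

iterate-induction : ∀ {A : Set} (P : A → Set) m {f : Fin m → A → A} {a} →
                    P a → (∀ i {a} → P a → P (f i a)) → P (iterate m f a)
iterate-induction P zero    Pa step = Pa
iterate-induction P (suc m) Pa step =
  iterate-induction P m (step (fromℕ m) Pa) (step ∘ inject₁)

iterate-fixed : ∀ {A : Set} m {f : Fin m → A → A} {a} →
                (∀ i → f i a ≡ a) → iterate m f a ≡ a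
iterate-fixed m {f} {a} eq =
  iterate-induction (_≡ a) m refl λ i a′≡a → trans (cong (f i) a′≡a) (eq i)

-- The loop runs downwards, so the last write is the one of the least i.
iterate-least :
  ∀ {A : Set} m {f : Fin m → A → A} {a} (W : Fin m → Set) (Q : Fin m → A → Set) →
  (∀ i → Dec (W i)) → (∀ i {a} → W i → Q i (f i a)) → (∀ i {a} → ¬ W i → f i a ≡ a) →
  (∃[ i ] W i × (∀ j → j Fin.< i → ¬ W j) × Q i (iterate m f a))
  ⊎ ((∀ i → ¬ W i) × iterate m f a ≡ a)
iterate-least zero W Q W? write keep = inj₂ ((λ ()) , refl)
iterate-least (suc m) {f} {a} W Q W? write keep
  rewrite iterate-suc m f a with W? zero
... | yes w = inj₁ (zero , w , (λ _ ()) , write zero w)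
... | no ¬w rewrite keep zero {iterate m (f ∘ suc) a} ¬w
  with iterate-least m {f ∘ suc} {a} (W ∘ suc) (Q ∘ suc) (W? ∘ suc) (write ∘ suc) (keep ∘ suc)
... | inj₁ (i , w , least , q) =
        inj₁ (suc i , w , (λ { zero _ → ¬w ; (suc j) (s≤s j<i) → least j j<i }) , q)
... | inj₂ (none , eq) = inj₂ ((λ { zero → ¬w ; (suc i) → none i }) , eq)

mat mat⁴ table : Ty
mat   = vec card (vec card bool)
mat⁴  = vec card (vec card mat)
table = vec card (vec card (vec card+1 (vec card+1 bool)))

vertex count set : Ty
vertex = fin card
count  = fin card+1
set    = vec card bool

at : ∀ {A : Set} {m n} → Vec (Vec A n) m → Fin m → Fin n → A
at M u v = Vec.lookup (Vec.lookup M u) v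

at-tabulate : ∀ {A : Set} {m n} (f : Fin m → Fin n → A) u v →
              at (Vec.tabulate λ u → Vec.tabulate (f u)) u v ≡ f u v
at-tabulate f u v =
  trans (cong (λ r → Vec.lookup r v) (lookup∘tabulate _ u)) (lookup∘tabulate (f u) v)

at-tabulate⁴ : ∀ {A : Set} {m n k l} (f : Fin m → Fin n → Fin k → Fin l → A) u v x y →
  at (at (Vec.tabulate λ u → Vec.tabulate λ v → Vec.tabulate λ x → Vec.tabulate (f u v x))
      u v) x y ≡ f u v x y
at-tabulate⁴ f u v x y = trans (cong (λ M → at M x y) (at-tabulate _ u v))
                               (at-tabulate (f u v) x y)

-- Both numbers are decremented together until one is zero; equal numbers reach zero at once. With
-- the first below n, n passes suffice.
sameᵗ : Term (nat ∷ nat ∷ []) bool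
sameᵗ = call (ite nat (op fst v0) (const ff) (ite nat (op snd v0) (const ff) (const tt)))
             (fold card (pair v0 v1)
                (ite nat (op fst v0)
                   (ite nat (op snd v0)
                      (pair (op pred (op fst v0)) (op pred (op snd v0))) v0) v0)
             ∷ [])

equalᵗ : Term (vertex ∷ vertex ∷ []) bool
equalᵗ = call sameᵗ (op number v0 ∷ op number v1 ∷ [])

same-correct : ∀ {n i j} → i < n → ⟦ sameᵗ ⟧[ n ] (i ∷ j ∷ []) ≡ true ⇔ i ≡ j
same-correct {n} i<n = go n _ _ (<⇒≤ i<n)
  where
  step : ℕ × ℕ → ℕ × ℕ
  step p = cond (isPositive (proj₁ p))
             (cond (isPositive (proj₂ p)) (ℕ.pred (proj₁ p) , ℕ.pred (proj₂ p)) p) p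
  final : ℕ × ℕ → Bool
  final p = cond (isPositive (proj₁ p)) false (cond (isPositive (proj₂ p)) false true)
  fixed : ∀ m i j → step (i , j) ≡ (i , j) → i ≡ 0 ⊎ j ≡ 0 →
          final (iterate m (λ _ → step) (i , j)) ≡ true ⇔ i ≡ j
  fixed m i j eq z rewrite iterate-fixed m {λ _ → step} (λ _ → eq) with i | j | z
  ... | zero  | zero  | _       = mk⇔ (λ _ → refl) (λ _ → refl)
  ... | zero  | suc _ | _       = mk⇔ (λ ()) (λ ())
  ... | suc _ | zero  | _       = mk⇔ (λ ()) (λ ())
  ... | suc _ | suc _ | inj₁ ()
  ... | suc _ | suc _ | inj₂ ()
  go : ∀ m i j → i ≤ m → final (iterate m (λ _ → step) (i , j)) ≡ true ⇔ i ≡ j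
  go m       zero    j       _         = fixed m zero j refl (inj₁ refl)
  go m       (suc i) zero    _         = fixed m (suc i) zero refl (inj₂ refl)
  go (suc m) (suc i) (suc j) (s≤s i≤m) =
    mk⇔ (cong suc ∘ to (go m i j i≤m)) (from (go m i j i≤m) ∘ suc-injective)

equal-correct : ∀ {n} {u v : Fin n} → ⟦ equalᵗ ⟧[ n ] (u ∷ v ∷ []) ≡ true ⇔ u ≡ v
equal-correct {u = u} =
  mk⇔ (toℕ-injective ∘ to (same-correct (toℕ<n u))) (from (same-correct (toℕ<n u)) ∘ cong toℕ)

nonadjacentᵗ : Term (mat ∷ []) mat
nonadjacentᵗ = tab card (tab card
  (andᵗ (notᵗ (v2 ! v1 ! v0)) (notᵗ (call equalᵗ (v1 ∷ v0 ∷ [])))))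

_⟨_,_⟩ : ∀ {n} → ⟦ mat ⟧ᵗ n → Fin n → Fin n → Set
M ⟨ u , v ⟩ = at M u v ≡ true

nonadjacent-correct : ∀ {n} (G : ⟦ mat ⟧ᵗ n) u v →
  ⟦ nonadjacentᵗ ⟧[ n ] (G ∷ []) ⟨ u , v ⟩ ⇔ (¬ G ⟨ u , v ⟩ × u ≢ v)
nonadjacent-correct {n} G u v = via (at-tabulate _ u v)
  (and-⇔ (not-⇔ (⇔-id _)) (not-⇔ equal-correct))

forcesᵗ : Term (mat ∷ vertex ∷ vertex ∷ vertex ∷ vertex ∷ []) bool
forcesᵗ = andᵗ (v0 ! v1 ! v2) (andᵗ (v0 ! v3 ! v4)
  (orᵗ (andᵗ (call equalᵗ (v1 ∷ v3 ∷ [])) (notᵗ (v0 ! v2 ! v4)))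
       (andᵗ (call equalᵗ (v2 ∷ v4 ∷ [])) (notᵗ (v0 ! v1 ! v3)))))

forces-correct : ∀ {n} (H : ⟦ mat ⟧ᵗ n) u v x y →
  ⟦ forcesᵗ ⟧[ n ] (H ∷ u ∷ v ∷ x ∷ y ∷ []) ≡ true ⇔ Forces (H ⟨_,_⟩) (u , v) (x , y)
forces-correct H u v x y = and-⇔ (⇔-id _) (and-⇔ (⇔-id _)
  (or-⇔ (and-⇔ equal-correct (not-⇔ (⇔-id _))) (and-⇔ equal-correct (not-⇔ (⇔-id _)))))

-- Warshall's algorithm on pairs of vertices.
throughᵗ : Term (mat⁴ ∷ vertex ∷ vertex ∷ []) mat⁴
throughᵗ = tab card (tab card (tab card (tab card
  (orᵗ (v4 ! v3 ! v2 ! v1 ! v0)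
       (andᵗ (v4 ! v3 ! v2 ! v5 ! v6) (v4 ! v5 ! v6 ! v1 ! v0))))))

closureᵗ : Term (mat ∷ []) mat⁴
closureᵗ = fold card
  (tab card (tab card (tab card (tab card
     (call forcesᵗ (v4 ∷ v3 ∷ v2 ∷ v1 ∷ v0 ∷ []))))))
  (fold card v0 (call throughᵗ (v0 ∷ v3 ∷ v1 ∷ [])))

Rel⁴ : ∀ {n} → ⟦ mat⁴ ⟧ᵗ n → (p q : Pair n) → Set
Rel⁴ R (u , v) (x , y) = at (at R u v) x y ≡ true

through-correct : ∀ {n} (R : ⟦ mat⁴ ⟧ᵗ n) (q p r : Pair n) →
  Rel⁴ (⟦ throughᵗ ⟧[ n ] (R ∷ proj₁ q ∷ proj₂ q ∷ [])) p r
  ⇔ (Rel⁴ R p r ⊎ Rel⁴ R p q × Rel⁴ R q r)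
through-correct {n} R (a , b) (u , v) (x , y) =
  via (at-tabulate⁴ _ u v x y) (or-⇔ (⇔-id _) (and-⇔ (⇔-id _) (⇔-id _)))

-- The invariant of Warshall's algorithm for a pair `q` that has been processed.
TransitiveThrough : ∀ {n} → ⟦ mat⁴ ⟧ᵗ n → Pair n → Set
TransitiveThrough R q = ∀ p r → Rel⁴ R p q → Rel⁴ R q r → Rel⁴ R p r

through-transitive : ∀ {n} (R : ⟦ mat⁴ ⟧ᵗ n) q →
  TransitiveThrough (⟦ throughᵗ ⟧[ n ] (R ∷ proj₁ q ∷ proj₂ q ∷ [])) q
through-transitive R q p r Rpq Rqr = from (through-correct R q p r) (inj₂
  ( [ id , proj₁ ] (to (through-correct R q p q) Rpq)
  , [ id , proj₂ ] (to (through-correct R q q r) Rqr)))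

through-preserves : ∀ {n} (R : ⟦ mat⁴ ⟧ᵗ n) q q′ → TransitiveThrough R q′ →
  TransitiveThrough (⟦ throughᵗ ⟧[ n ] (R ∷ proj₁ q ∷ proj₂ q ∷ [])) q′
through-preserves R q q′ tr p r Rpq′ Rq′r = from (through-correct R q p r)
  (case (to (through-correct R q p q′) Rpq′) (to (through-correct R q q′ r) Rq′r))
  where
  case : _ → _ → _
  case (inj₁ pq′)         (inj₁ q′r)         = inj₁ (tr p r pq′ q′r)
  case (inj₁ pq′)         (inj₂ (q′q , qr))  = inj₂ (tr p q pq′ q′q , qr)
  case (inj₂ (pq , qq′))  (inj₁ q′r)         = inj₂ (pq , tr q r qq′ q′r)
  -- Both halves already pass through `q`, so the detour to `q′` is cut out.
  case (inj₂ (pq , _))    (inj₂ (_ , qr))    = inj₂ (pq , qr)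

iterate-covers : ∀ {A : Set} m {f : Fin m → A → A} {a} (P : Fin m → A → Set) →
  (∀ i a → P i (f i a)) → (∀ i j {a} → P j a → P j (f i a)) → ∀ i → P i (iterate m f a)
iterate-covers (suc m) {f} {a} P hit keep i rewrite iterate-suc m f a with i
... | zero  = hit zero _
... | suc i = keep zero (suc i)
                (iterate-covers m (P ∘ suc) (hit ∘ suc) (λ i j → keep (suc i) (suc j)) i)

module _ {n} (H : ⟦ mat ⟧ᵗ n) where

  private
    R = ⟦ closureᵗ ⟧[ n ] (H ∷ [])

    initially : ∀ p q → _ ⇔ Forces (H ⟨_,_⟩) p q
    initially (u , v) (x , y) =
      via (at-tabulate⁴ (λ u v x y → ⟦ forcesᵗ ⟧[ n ] (H ∷ u ∷ v ∷ x ∷ y ∷ [])) u v x y)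
          (forces-correct H u v x y)

  closure-step : ∀ p q → Forces (H ⟨_,_⟩) p q → Rel⁴ R p q
  closure-step p q Hpq = iterate-induction (λ R → Rel⁴ R p q) n
    (from (initially p q) Hpq)
    λ a → λ Rpq → iterate-induction (λ R → Rel⁴ R p q) n Rpq
      λ b {R} Rpq → from (through-correct R (a , b) p q) (inj₁ Rpq)

  closure-least : (S : (p q : Pair n) → Set) → (∀ {p q r} → S p q → S q r → S p r) →
                  (∀ {p q} → Forces (H ⟨_,_⟩) p q → S p q) → ∀ p q → Rel⁴ R p q → S p q
  closure-least S S-trans Forces⊆S = iterate-induction (λ R → ∀ p q → Rel⁴ R p q → S p q) n
    (λ p q → Forces⊆S ∘ to (initially p q))
    λ a R⊆S → iterate-induction (λ R → ∀ p q → Rel⁴ R p q → S p q) n R⊆S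
      λ b {R} R⊆S p q → [ R⊆S p q , (λ (x , y) → S-trans (R⊆S _ _ x) (R⊆S _ _ y)) ]
                    ∘ to (through-correct R (a , b) p q)

  closure-transitive : ∀ p q r → Rel⁴ R p q → Rel⁴ R q r → Rel⁴ R p r
  closure-transitive p (a , b) r = iterate-covers n (λ a R → ∀ b → TransitiveThrough R (a , b))
    (λ a R → iterate-covers n (λ b R → TransitiveThrough R (a , b))
      (λ b R → through-transitive R (a , b))
      (λ b b′ {R} → through-preserves R (a , b) (a , b′)))
    (λ a a′ tr b′ → iterate-induction (λ R → TransitiveThrough R (a′ , b′)) n (tr b′)
      λ b {R} → through-preserves R (a , b) (a′ , b′))
    a b p r

-- The pair that writes last is the lexicographically least one.
orientᵗ : Term (mat ∷ mat⁴ ∷ []) mat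
orientᵗ = tab card (tab card (andᵗ (v2 ! v1 ! v0)
  (fold card (const ff) (fold card v0
    (ite bool (v7 ! v5 ! v4 ! v3 ! v1) (const tt)
      (ite bool (v7 ! v5 ! v4 ! v1 ! v3) (const ff) v0))))))

module _ {n} (H : ⟦ mat ⟧ᵗ n) (R : ⟦ mat⁴ ⟧ᵗ n) where

  private
    scanRow : Fin n → Fin n → Fin n → Bool → Bool
    scanRow u v p = iterate n λ r a →
      cond (at (at R u v) p r) true (cond (at (at R u v) r p) false a)

    scan : Fin n → Fin n → Bool
    scan u v = iterate n (scanRow u v) false

    touches? : ∀ u v p r → Dec (Touches (Rel⁴ R) u v p r)
    touches? u v p r = at (at R u v) p r ≟ true ⊎-dec at (at R u v) r p ≟ true

    -- A touched pair overwrites the accumulator with its own membership in the class; for the least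
    -- touched pair this is the condition that puts uv into `F`.
    write : ∀ u v p r {a} → Touches (Rel⁴ R) u v p r →
      cond (at (at R u v) p r) true (cond (at (at R u v) r p) false a) ≡ at (at R u v) p r
    write u v p r t with at (at R u v) p r | at (at R u v) r p | t
    ... | true  | _    | _         = refl
    ... | false | true | _         = refl
    ... | false | false | inj₁ ()
    ... | false | false | inj₂ ()

    keep : ∀ u v p r {a} → ¬ Touches (Rel⁴ R) u v p r →
      cond (at (at R u v) p r) true (cond (at (at R u v) r p) false a) ≡ a
    keep u v p r ¬t with at (at R u v) p r | at (at R u v) r p
    ... | true  | _     = contradiction (inj₁ refl) ¬t
    ... | false | true  = contradiction (inj₂ refl) ¬t
    ... | false | false = refl

    RowResult : Fin n → Fin n → Fin n → Bool → Set
    RowResult u v p b = ∃[ r ] Touches (Rel⁴ R) u v p r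
      × (∀ r′ → r′ Fin.< r → ¬ Touches (Rel⁴ R) u v p r′) × b ≡ at (at R u v) p r

    row : ∀ u v p a → RowResult u v p (scanRow u v p a)
                    ⊎ (∀ r → ¬ Touches (Rel⁴ R) u v p r) × scanRow u v p a ≡ a
    row u v p a = iterate-least n (Touches (Rel⁴ R) u v p) (λ r b → b ≡ at (at R u v) p r)
      (touches? u v p) (λ r → write u v p r) (λ r → keep u v p r)

    result : ∀ u v →
      (∃[ p ] ∃[ r ] LeastTouched (Rel⁴ R) u v p r × scan u v ≡ at (at R u v) p r)
      ⊎ (∀ p r → ¬ Touches (Rel⁴ R) u v p r) × scan u v ≡ false
    result u v with iterate-least n {scanRow u v} {false}
        -- For the outer loop, a row counts as writing when it touches some second vertex.
        (λ p → ∃[ r ] Touches (Rel⁴ R) u v p r) (RowResult u v)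
        (λ p → any? (touches? u v p))
        (λ p {a} (r , t) → [ id , (λ (none , _) → contradiction t (none r)) ]′ (row u v p a))
        (λ p {a} none → [ (λ (r , t , _) → contradiction (r , t) none) , proj₂ ]′ (row u v p a))
    ... | inj₁ (p , _ , p-least , r , t , r-least , eq) = inj₁
      ( p , r , leastTouched t (λ p′<p r′ t′ → p-least _ p′<p (r′ , t′)) (λ r′<r → r-least _ r′<r)
      , eq)
    ... | inj₂ (none , eq) = inj₂ ((λ p r t → none p (r , t)) , eq)

  touched : ∀ u v → Rel⁴ R (u , v) (u , v) → ∃[ p ] ∃[ r ] LeastTouched (Rel⁴ R) u v p r
  touched u v Ruv = [ (λ (p , r , l , _) → p , r , l)
                    , (λ (none , _) → contradiction (inj₁ Ruv) (none u v)) ] (result u v)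

  orient-correct : ∀ u v → ⟦ orientᵗ ⟧[ n ] (H ∷ R ∷ []) ⟨ u , v ⟩
    ⇔ (H ⟨ u , v ⟩ × ∃[ p ] ∃[ r ] LeastTouched (Rel⁴ R) u v p r × Rel⁴ R (u , v) (p , r))
  orient-correct u v = via (at-tabulate _ u v) (and-⇔ (⇔-id (H ⟨ u , v ⟩)) (mk⇔ found unique))
    where
    found : scan u v ≡ true → _
    found t with result u v
    ... | inj₁ (p , r , l , eq) = p , r , l , trans (sym eq) t
    ... | inj₂ (_ , eq)         = contradiction (trans (sym t) eq) λ ()
    unique : ∃[ p ] ∃[ r ] LeastTouched (Rel⁴ R) u v p r × Rel⁴ R (u , v) (p , r) →
             scan u v ≡ true
    unique (p , r , l , Rpr) with result u v
    ... | inj₂ (none , _) = contradiction (inj₁ Rpr) (none p r)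
    ... | inj₁ (p′ , r′ , l′ , eq) with least-unique l l′
    ... | refl = trans eq Rpr

closure-isClosure : ∀ {n} (H : ⟦ mat ⟧ᵗ n) →
  IsClosure (Forces (H ⟨_,_⟩)) (Rel⁴ (⟦ closureᵗ ⟧[ n ] (H ∷ [])))
closure-isClosure H = record
  { step       = closure-step H _ _
  ; transitive = closure-transitive H _ _ _
  ; least      = λ S S-trans Forces⊆S → closure-least H S S-trans Forces⊆S _ _
  }

transport : ∀ {n} {H H′ P : Rel (Fin n)} → (∀ u v → H u v ⇔ H′ u v) →
            IsTransitiveOrientation H P → IsTransitiveOrientation H′ P
transport e o = record { sound = to (e _ _) ∘ sound ; total = total ∘ from (e _ _)
                       ; P-trans = P-trans }
  where open IsTransitiveOrientation o

abstract
  orientationᵗ : Term (mat ∷ []) mat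
  orientationᵗ = call (call orientᵗ (v0 ∷ call closureᵗ (v0 ∷ []) ∷ []))
                      (call nonadjacentᵗ (v0 ∷ []) ∷ [])

  orientation-correct : ∀ {n} (G : ⟦ mat ⟧ᵗ n) → (∀ {u v} → G ⟨ u , v ⟩ → G ⟨ v , u ⟩) →
    ∀ {P} → IsTransitiveOrientation (λ u v → ¬ G ⟨ u , v ⟩ × u ≢ v) P →
    IsTransitiveOrientation (λ u v → ¬ G ⟨ u , v ⟩ × u ≢ v)
                            (⟦ orientationᵗ ⟧[ n ] (G ∷ []) ⟨_,_⟩)
  orientation-correct {n} G G-sym {P} P-orients = transport H⇔ (Orientation.F-orients
    (λ u v → at H u v ≟ true)
    (λ Huv → from (H⇔ _ _) (let ¬G , u≢v = to (H⇔ _ _) Huv in ¬G ∘ G-sym , u≢v ∘ sym))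
    (λ Huu → proj₂ (to (H⇔ _ _) Huu) refl)
    (transport (λ u v → mk⇔ (from (H⇔ u v)) (to (H⇔ u v))) P-orients)
    (closure-isClosure H)
    (orient-correct H R) (touched H R))
    where
    H : ⟦ mat ⟧ᵗ n
    H = ⟦ nonadjacentᵗ ⟧[ n ] (G ∷ [])
    R : ⟦ mat⁴ ⟧ᵗ n
    R = ⟦ closureᵗ ⟧[ n ] (H ∷ [])
    H⇔ : ∀ u v → H ⟨ u , v ⟩ ⇔ (¬ G ⟨ u , v ⟩ × u ≢ v)
    H⇔ = nonadjacent-correct G

-- The dynamic programming table

implies-⇔ : ∀ {p q} {P Q : Set} → p ≡ true ⇔ P → q ≡ true ⇔ Q → cond p q true ≡ true ⇔ (P → Q)
implies-⇔ {true}  e f = mk⇔ (λ t _ → to f t) (λ g → from f (g (to e refl)))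
implies-⇔ {false} e f = mk⇔ (λ _ x → contradiction (from e x) λ ()) (λ _ → refl)

∈-⇔ : ∀ {n} {S : Subset n} {x} → Vec.lookup S x ≡ true ⇔ x ∈ S
∈-⇔ {S = S} {x} = mk⇔ (lookup⇒[]= x S) []=⇒lookup

∈-tabulate : ∀ {n} (f : Fin n → Bool) {P : Set} {x} → f x ≡ true ⇔ P → x ∈ Vec.tabulate f ⇔ P
∈-tabulate f {x = x} e = mk⇔
  (λ x∈ → to e (trans (sym (lookup∘tabulate f x)) ([]=⇒lookup x∈)))
  (λ p → lookup⇒[]= x _ (trans (lookup∘tabulate f x) (from e p)))

aboveᵗ : Term (mat ∷ vertex ∷ vertex ∷ []) set
aboveᵗ = tab card (andᵗ (v1 ! v2 ! v0) (v1 ! v3 ! v0))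

above-correct : ∀ {n} (F : ⟦ mat ⟧ᵗ n) {u v x} →
  x ∈ ⟦ aboveᵗ ⟧[ n ] (F ∷ u ∷ v ∷ []) ⇔ (F ⟨ u , x ⟩ × F ⟨ v , x ⟩)
above-correct F = ∈-tabulate _ (and-⇔ (⇔-id _) (⇔-id _))

blockᵗ : Term (mat ∷ set ∷ vertex ∷ vertex ∷ []) set
blockᵗ = tab card (andᵗ (v2 ! v0)
  (allᵗ card (ite bool (andᵗ (v2 ! v4 ! v0) (v2 ! v5 ! v0)) (v2 ! v1 ! v0) (const tt))))

block-correct : ∀ {n} (F : ⟦ mat ⟧ᵗ n) {S u v x} →
  x ∈ ⟦ blockᵗ ⟧[ n ] (F ∷ S ∷ u ∷ v ∷ [])
  ⇔ (x ∈ S × (∀ y → F ⟨ u , y ⟩ × F ⟨ v , y ⟩ → F ⟨ x , y ⟩))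
block-correct {n} F = ∈-tabulate _ (and-⇔ ∈-⇔
  (all-⇔ n λ y → implies-⇔ (and-⇔ (⇔-id _) (⇔-id _)) (⇔-id _)))

minusᵗ : Term (count ∷ set ∷ []) count
minusᵗ = fold card v0 (ite bool (v3 ! v1) (op predᶠ v0) v0)

minus-correct : ∀ {n} (i : Fin (suc n)) D →
                toℕ (⟦ minusᵗ ⟧[ n ] (i ∷ D ∷ [])) ≡ toℕ i ∸ ∣ D ∣
minus-correct i D = go D i
  where
  go : ∀ {m k} (D : Subset m) (i : Fin k) →
       toℕ (iterate m (λ x a → cond (Vec.lookup D x) (predFin a) a) i) ≡ toℕ i ∸ ∣ D ∣
  go []      i = refl
  go {suc m} (d ∷ D) i
    rewrite iterate-suc m (λ x a → cond (Vec.lookup (d ∷ D) x) (predFin a) a) i with d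
  ... | false = go D i
  ... | true  = trans
      (toℕ-predFin (iterate m (λ x a → cond (Vec.lookup D x) (predFin a) a) i))
      (trans (cong ℕ.pred (go D i)) (pred[m∸n]≡m∸[1+n] (toℕ i) ∣ D ∣))

extendᵗ : Term (table ∷ vertex ∷ vertex ∷ count ∷ count ∷ set ∷ []) bool
extendᵗ = orᵗ (v0 ! v1 ! v2 ! call minusᵗ (v3 ∷ v5 ∷ []) ! v4)
              (v0 ! v1 ! v2 ! v3 ! call minusᵗ (v4 ∷ v5 ∷ []))

isZeroᵗ : ∀ {Γ e} → Term Γ (fin e) → Term Γ bool
isZeroᵗ t = ite fin t (const ff) (const tt)

-- The set is an argument, since the rounds use the common upper bounds of a pair and the final
-- query all vertices.
bestᵗ : Term (mat ∷ table ∷ set ∷ count ∷ count ∷ []) bool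
bestᵗ = orᵗ (andᵗ (isZeroᵗ v3) (isZeroᵗ v4))
  (existsᵗ card (existsᵗ card (andᵗ (v4 ! v1) (andᵗ (v4 ! v0)
    (call extendᵗ (v3 ∷ v1 ∷ v0 ∷ v5 ∷ v6 ∷ call blockᵗ (v2 ∷ v4 ∷ v1 ∷ v0 ∷ []) ∷ []))))))

roundᵗ : Term (table ∷ mat ∷ []) table
roundᵗ = tab card (tab card (tab card+1 (tab card+1
  (call bestᵗ (v5 ∷ v4 ∷ call aboveᵗ (v5 ∷ v3 ∷ v2 ∷ []) ∷ v1 ∷ v0 ∷ [])))))

tableᵗ : Term (mat ∷ []) table
tableᵗ = fold card (tab card (tab card (tab card+1 (tab card+1 (const ff)))))
                    (call roundᵗ (v0 ∷ v2 ∷ []))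

isZero-⇔ : ∀ m → cond (isPositive m) false true ≡ true ⇔ m ≡ 0
isZero-⇔ zero    = mk⇔ (λ _ → refl) (λ _ → refl)
isZero-⇔ (suc m) = mk⇔ (λ ()) (λ ())

module Tables {n} (F : ⟦ mat ⟧ᵗ n) {Q : Rel (Fin n)}
              (dim2 : TwoDimensional (F ⟨_,_⟩) Q) where

  open Colorings dim2 public
  open Dynamic (λ u v → ⟦ aboveᵗ ⟧[ n ] (F ∷ u ∷ v ∷ [])) (above-correct F)
               (λ S u v → ⟦ blockᵗ ⟧[ n ] (F ∷ S ∷ u ∷ v ∷ [])) (block-correct F) public

  Tabulates : ⟦ table ⟧ᵗ n → (Fin n → Fin n → ℕ → ℕ → Set) → Set
  Tabulates A T = ∀ u v i j → at (at A u v) i j ≡ true ⇔ T u v (toℕ i) (toℕ j)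

  best-correct : ∀ A T → Tabulates A T → ∀ S i j →
    ⟦ bestᵗ ⟧[ n ] (F ∷ A ∷ S ∷ i ∷ j ∷ []) ≡ true ⇔ Best T S (toℕ i) (toℕ j)
  best-correct A T e S i j = or-⇔ (and-⇔ (isZero-⇔ (toℕ i)) (isZero-⇔ (toℕ j)))
    (exists-⇔ n λ u → exists-⇔ n λ v → and-⇔ ∈-⇔ (and-⇔ ∈-⇔ (extend-⇔ u v)))
    where
    extend-⇔ : ∀ u v → _
    extend-⇔ u v = or-⇔
      (subst (λ k → at (at A u v) i∸D j ≡ true ⇔ T u v k (toℕ j)) (minus-correct i D)
             (e u v i∸D j))
      (subst (λ k → at (at A u v) i j∸D ≡ true ⇔ T u v (toℕ i) k) (minus-correct j D)
             (e u v i j∸D))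
      where
      D = ⟦ blockᵗ ⟧[ n ] (F ∷ S ∷ u ∷ v ∷ [])
      i∸D = ⟦ minusᵗ ⟧[ n ] (i ∷ D ∷ [])
      j∸D = ⟦ minusᵗ ⟧[ n ] (j ∷ D ∷ [])

  table-correct : Tabulates (⟦ tableᵗ ⟧[ n ] (F ∷ [])) (Table n)
  table-correct = go n
    where
    start : ⟦ table ⟧ᵗ n
    start = Vec.tabulate λ _ → Vec.tabulate λ _ → Vec.tabulate λ _ → Vec.tabulate λ _ → false
    round : ⟦ table ⟧ᵗ n → ⟦ table ⟧ᵗ n
    round A = ⟦ roundᵗ ⟧[ n ] (A ∷ F ∷ [])
    entry : ⟦ table ⟧ᵗ n → Fin n → Fin n → Fin (suc n) → Fin (suc n) → Bool
    entry A u v i j = ⟦ bestᵗ ⟧[ n ] (F ∷ A ∷ ⟦ aboveᵗ ⟧[ n ] (F ∷ u ∷ v ∷ []) ∷ i ∷ j ∷ [])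
    go : ∀ k → Tabulates (iterate k (λ _ → round) start) (Table k)
    go zero    u v i j = via (at-tabulate⁴ (λ _ _ _ _ → false) u v i j) (mk⇔ (λ ()) λ ())
    go (suc k) u v i j = via (cong (λ A → at (at A u v) i j) (iterate-suc k (λ _ → round) start))
      (via (at-tabulate⁴ (entry (iterate k (λ _ → round) start)) u v i j)
           (best-correct (iterate k (λ _ → round) start) (Table k) (go k)
              (⟦ aboveᵗ ⟧[ n ] (F ∷ u ∷ v ∷ [])) i j))

-- Searching for a coloring

halveᵗ : Term (nat ∷ []) (nat ⊗ nat)
halveᵗ = fold card (pair v0 (const zero))
  (ite nat (op fst v0)
    (ite nat (op pred (op fst v0))
      (pair (op pred (op pred (op fst v0))) (op suc (op snd v0))) v0) v0)

Halves : ℕ → ℕ × ℕ → Set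
Halves m (r , h) = (r ≡ 0 × m ≡ 2 * h) ⊎ (r ≡ 1 × m ≡ suc (2 * h))

halve-correct : ∀ {n m} → m ≤ n → Halves m (⟦ halveᵗ ⟧[ n ] (m ∷ []))
halve-correct {n} {m} m≤n = go n m 0 (m≤n⇒m≤1+n m≤n) (+-identityʳ m)
  where
  step : ℕ × ℕ → ℕ × ℕ
  step p = cond (isPositive (proj₁ p)) (cond (isPositive (ℕ.pred (proj₁ p)))
             (ℕ.pred (ℕ.pred (proj₁ p)) , suc (proj₂ p)) p) p
  go : ∀ k r h → r ≤ suc k → r + 2 * h ≡ m → Halves m (iterate k (λ _ → step) (r , h))
  go k 0 h _ eq rewrite iterate-fixed k {λ _ → step} {0 , h} (λ _ → refl) = inj₁ (refl , sym eq)
  go k 1 h _ eq rewrite iterate-fixed k {λ _ → step} {1 , h} (λ _ → refl) = inj₂ (refl , sym eq)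
  go zero    (suc (suc r)) h (s≤s ()) eq
  go (suc k) (suc (suc r)) h (s≤s (s≤s r≤k)) eq = go k r (suc h) (m≤n⇒m≤1+n r≤k)
    (trans (cong (λ k → r + k) (*-suc 2 h)) (trans (+-suc r _) (trans (cong suc (+-suc r _)) eq)))

-- A mismatch of parity and digit is recorded as the number 0 with further
-- digits to come, a state that never changes again.
consumeᵗ : Term ((nat ⊗ nat) ∷ digits ∷ []) (nat ⊗ digits)
consumeᵗ = ite bool (op digit v1) (ite nat (op fst v0) mismatch match)
                                  (ite nat (op fst v0) match mismatch)
  where
  match mismatch : Term ((nat ⊗ nat) ∷ digits ∷ []) (nat ⊗ digits)
  match    = pair (op snd v0) (op further v1)
  mismatch = pair (const zero) v1

-- A positive m has least digit 2 or 1 according as m - 1 is odd or even, and half of m - 1, rounded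
-- down, has the remaining digits. The number falls with each digit, so n + 1 rounds suffice however
-- long the digit string is.
decodeᵗ : Term (nat ∷ digits ∷ []) (nat ⊗ digits)
decodeᵗ = fold card+1 (pair v0 v1)
  (ite digits (op snd v0) (ite nat (op fst v0)
     (call consumeᵗ (call halveᵗ (op pred (op fst v0) ∷ []) ∷ op snd v0 ∷ [])) v0) v0)

denotesᵗ : Term (nat ∷ digits ∷ []) bool
denotesᵗ = call (ite nat (op fst v0) (const ff) (ite digits (op snd v0) (const ff) (const tt)))
                (decodeᵗ ∷ [])

digitsOf : ℕᵇ → List Bool
digitsOf ℕᵇ.zero  = []
digitsOf 2[1+ x ] = false ∷ digitsOf x
digitsOf 1+[2 x ] = true ∷ digitsOf x

encodeℕᵇ-digits : ∀ x {n} → encodeℕᵇ x ≡ enc digits {n} (digitsOf x)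
encodeℕᵇ-digits ℕᵇ.zero  = refl
encodeℕᵇ-digits 2[1+ x ] = cong (cons nil) (encodeℕᵇ-digits x {0})
encodeℕᵇ-digits 1+[2 x ] = cong (cons (cons nil nil)) (encodeℕᵇ-digits x {0})

denotes-correct : ∀ {n m} x → m ≤ n →
                  ⟦ denotesᵗ ⟧[ n ] (m ∷ digitsOf x ∷ []) ≡ true ⇔ m ≡ ℕᵇ.toℕ x
denotes-correct {n} x m≤n = go (suc n) _ x (m≤n⇒m≤1+n m≤n) m≤n
  where
  State = ℕ × List Bool
  consume : ℕ × ℕ → List Bool → State
  consume h ds = ⟦ consumeᵗ ⟧[ n ] (h ∷ ds ∷ [])
  step : State → State
  step p = cond (test digits (proj₂ p)) (cond (isPositive (proj₁ p))
    (consume (⟦ halveᵗ ⟧[ n ] (ℕ.pred (proj₁ p) ∷ [])) (proj₂ p)) p) p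
  final : State → Bool
  final p = cond (isPositive (proj₁ p)) false (cond (test digits (proj₂ p)) false true)
  run : ℕ → State → State
  run k = iterate k (λ _ → step)
  stuck : ∀ k d ds → final (run k (0 , d ∷ ds)) ≡ false
  stuck k d ds rewrite iterate-fixed k {λ _ → step} {0 , d ∷ ds} (λ _ → refl) = refl
  reject : ∀ {p} {P : Set} → p ≡ false → ¬ P → p ≡ true ⇔ P
  reject refl ¬P = mk⇔ (λ ()) (λ x → contradiction x ¬P)
  half≤ : ∀ {k m h} → m ≤ k → m ≡ 2 * h ⊎ m ≡ suc (2 * h) → h ≤ k
  half≤ {h = h} m≤k (inj₁ refl) = ≤-trans (m≤m+n h _) m≤k
  half≤ {h = h} m≤k (inj₂ refl) = ≤-trans (m≤n⇒m≤1+n (m≤m+n h _)) m≤k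
  -- The bound by `k` ensures enough rounds, the bound by `n` the correctness of halving.
  go : ∀ k m x → m ≤ k → m ≤ n → final (run k (m , digitsOf x)) ≡ true ⇔ m ≡ ℕᵇ.toℕ x
  go k zero ℕᵇ.zero _ _
    rewrite iterate-fixed k {λ _ → step} {0 , []} (λ _ → refl) = mk⇔ (λ _ → refl) (λ _ → refl)
  go k (suc m) ℕᵇ.zero _ _
    rewrite iterate-fixed k {λ _ → step} {suc m , []} (λ _ → refl) = mk⇔ (λ ()) (λ ())
  go k zero 2[1+ x ] _ _ = reject (stuck k false (digitsOf x)) λ ()
  go k zero 1+[2 x ] _ _ = reject (stuck k true (digitsOf x)) λ ()
  go (suc k) (suc m) 2[1+ x ] (s≤s m≤k) m<n
    with ⟦ halveᵗ ⟧[ n ] (m ∷ []) | halve-correct (<⇒≤ m<n)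
  ... | 0 , h | inj₁ (_ , refl) = reject (stuck k false (digitsOf x))
          λ eq → even≢odd h (ℕᵇ.toℕ x) (suc-injective (trans eq (*-suc 2 (ℕᵇ.toℕ x))))
  ... | 1 , h | inj₂ (_ , refl) = mk⇔
          (λ t → trans (cong (λ h → 2 + 2 * h) (to ih t)) (sym (*-suc 2 (ℕᵇ.toℕ x))))
          (λ eq → from ih (*-cancelˡ-≡ h (ℕᵇ.toℕ x) 2
            (suc-injective (suc-injective (trans eq (*-suc 2 (ℕᵇ.toℕ x)))))))
    where
    ih = go k h x (half≤ {m = m} m≤k (inj₂ refl)) (half≤ {m = m} (<⇒≤ m<n) (inj₂ refl))
  go (suc k) (suc m) 1+[2 x ] (s≤s m≤k) m<n
    with ⟦ halveᵗ ⟧[ n ] (m ∷ []) | halve-correct (<⇒≤ m<n)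
  ... | 1 , h | inj₂ (_ , refl) = reject (stuck k true (digitsOf x))
          λ eq → even≢odd (ℕᵇ.toℕ x) h (sym (suc-injective eq))
  ... | 0 , h | inj₁ (_ , refl) = mk⇔
          (λ t → cong (λ h → 1 + 2 * h) (to ih t))
          (λ eq → from ih (*-cancelˡ-≡ h (ℕᵇ.toℕ x) 2 (suc-injective eq)))
    where
    ih = go k h x (half≤ {m = m} m≤k (inj₁ refl)) (half≤ {m = m} (<⇒≤ m<n) (inj₁ refl))

everything : ∀ n → Subset n
everything n = Vec.tabulate λ _ → true

∈everything : ∀ {n} {x : Fin n} → x ∈ everything n
∈everything {x = x} = from (∈-tabulate (λ _ → true) {x ≡ x} (mk⇔ (λ _ → refl) (λ _ → refl))) refl

abstract
  searchᵗ : Term (mat ∷ digits ∷ digits ∷ []) bool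
  searchᵗ = existsᵗ card+1 (existsᵗ card+1
    (andᵗ (call denotesᵗ (op number v1 ∷ v3 ∷ []))
    (andᵗ (call denotesᵗ (op number v0 ∷ v4 ∷ []))
          (call bestᵗ (v2 ∷ call tableᵗ (v2 ∷ []) ∷ tab card (const tt) ∷ v1 ∷ v0 ∷ [])))))

  search-correct : ∀ {n} (F : ⟦ mat ⟧ᵗ n) {Q : Rel (Fin n)}
    (dim2 : TwoDimensional (F ⟨_,_⟩) Q) x y →
    ⟦ searchᵗ ⟧[ n ] (F ∷ digitsOf x ∷ digitsOf y ∷ []) ≡ true
    ⇔ (∃[ i ] ∃[ j ] toℕ i ≡ ℕᵇ.toℕ x × toℕ j ≡ ℕᵇ.toℕ y
         × Tables.Best F dim2 (Tables.Table F dim2 n) (everything n)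
             (toℕ {suc n} i) (toℕ {suc n} j))
  search-correct {n} F dim2 x y = exists-⇔ (suc n) λ i → exists-⇔ (suc n) λ j →
    and-⇔ (denotes-correct x (s≤s⁻¹ (toℕ<n i))) (and-⇔ (denotes-correct y (s≤s⁻¹ (toℕ<n j)))
      (Tables.best-correct F dim2 (⟦ tableᵗ ⟧[ n ] (F ∷ [])) (Tables.Table F dim2 n)
      (Tables.table-correct F dim2) (everything n) i j))

integer input : Ty
integer = bool ⊗ digits
input   = mat ⊗ integer ⊗ integer

decideᵗ : Term (input ∷ []) bool
decideᵗ = ite bool (op fst b) (const ff) (ite bool (op fst w) (const ff)
  (call searchᵗ (call orientationᵗ (op fst v0 ∷ []) ∷ op snd b ∷ op snd w ∷ [])))
  where
  b w : Term (input ∷ []) integer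
  b = op fst (op snd v0)
  w = op snd (op snd v0)

-- The program

-- The complementarity of their edge sets is all that ties `F`, which is computed, to `Q`, which
-- comes from the diagram.
twoDimensional : ∀ {n} {A F Q : Rel (Fin n)} →
  (∀ u v → Dec (A u v)) → (∀ u v → Dec (F u v)) → (∀ u v → Dec (Q u v)) →
  (∀ {u v} → A u v → A v u) → (∀ {u} → ¬ A u u) →
  IsTransitiveOrientation (λ u v → ¬ A u v × u ≢ v) F → IsTransitiveOrientation A Q →
  TwoDimensional F Q
twoDimensional {A = A} {F} {Q} A? F? Q? A-sym A-irrefl F-orients Q-orients = record
  { F? = F? ; Q? = Q? ; F-trans = F.P-trans ; Q-trans = Q.P-trans
  ; F-irrefl = λ Fuu → proj₂ (F.sound Fuu) refl ; Q-irrefl = A-irrefl ∘ Q.sound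
  ; exclusive = λ Fuv → proj₁ (F.sound Fuv) ∘ [ Q.sound , A-sym ∘ Q.sound ]
  ; trichot = trichot }
  where
  module F = IsTransitiveOrientation F-orients
  module Q = IsTransitiveOrientation Q-orients
  trichot : ∀ u v → u ≡ v ⊎ (F u v ⊎ F v u) ⊎ (Q u v ⊎ Q v u)
  trichot u v with u Finₚ.≟ v | A? u v
  ... | yes u≡v | _      = inj₁ u≡v
  ... | no u≢v  | yes a  = inj₂ (inj₂ (Q.total a))
  ... | no u≢v  | no ¬a  = inj₂ (inj₁ (F.total (¬a , u≢v)))

matrix : ∀ {n} → Graph n → ⟦ mat ⟧ᵗ n
matrix G = Vec.tabulate λ u → Vec.tabulate (Graph.adj G u)

matrix-adj : ∀ {n} (G : Graph n) u v → matrix G ⟨ u , v ⟩ ⇔ Graph.Adj G u v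
matrix-adj G u v = via (at-tabulate (Graph.adj G) u v) (mk⇔ (from T-≡) (to T-≡))

orientation : ∀ {n} → Graph n → ⟦ mat ⟧ᵗ n
orientation {n} G = ⟦ orientationᵗ ⟧[ n ] (matrix G ∷ [])

module _ {n} (G : Graph n) {F : ⟦ mat ⟧ᵗ n} {Q : Rel (Fin n)}
         (F-orients : IsTransitiveOrientation (λ u v → ¬ Graph.Adj G u v × u ≢ v) (F ⟨_,_⟩))
         (dim2 : TwoDimensional (F ⟨_,_⟩) Q) where
  open IsTransitiveOrientation F-orients
  open Tables F dim2

  coloring-correct : ∀ b w → ⟦ searchᵗ ⟧[ n ]
      (F ∷ digitsOf (ℕᵇ.fromℕ b) ∷ digitsOf (ℕᵇ.fromℕ w) ∷ []) ≡ true
    ⇔ HasBlackAndWhiteColoring G (+ b) (+ w)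
  coloring-correct b w = mk⇔ (found ∘ to search) (from search ∘ complete)
    where
    search = search-correct F dim2 (ℕᵇ.fromℕ b) (ℕᵇ.fromℕ w)
    found : _ → HasBlackAndWhiteColoring G (+ b) (+ w)
    found (i , j , i≡ , j≡ , best)
      with Best-sound (λ _ _ → ∈everything) (Table-sound n) best
    ... | coloring {B} {W} _ _ cmp B≥ W≥
      -- Surplus vertices are dropped here; nonadjacency passes to subsets.
      with subset-of-size B b (subst (_≤ ∣ B ∣) (trans i≡ (ℕᵇ.toℕ-fromℕ b)) B≥)
         | subset-of-size W w (subst (_≤ ∣ W ∣) (trans j≡ (ℕᵇ.toℕ-fromℕ w)) W≥)
    ... | B′ , B′⊆ , ∣B′∣ | W′ , W′⊆ , ∣W′∣ = B′ , W′
      , (λ (x , x∈) → let x∈B , x∈W = x∈p∩q⁻ B′ W′ x∈ in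
           proj₂ ([ sound , sound ]′ (cmp (B′⊆ x∈B) (W′⊆ x∈W))) refl)
      , cong +_ ∣B′∣ , cong +_ ∣W′∣
      , λ u v u∈ v∈ → [ proj₁ ∘ sound , (λ Fvu → proj₁ (sound Fvu) ∘ Adj-sym G) ]′
                        (cmp (B′⊆ u∈) (W′⊆ v∈))
    complete : HasBlackAndWhiteColoring G (+ b) (+ w) → _
    complete (B , W , disjoint , ∣B∣ , ∣W∣ , ¬adj) =
      fromℕ< b≤n , fromℕ< w≤n
      , trans (toℕ-fromℕ< b≤n) (sym (ℕᵇ.toℕ-fromℕ b))
      , trans (toℕ-fromℕ< w≤n) (sym (ℕᵇ.toℕ-fromℕ w))
      , Best-complete n
          (coloring {black = B} {W} (λ _ → ∈everything) (λ _ → ∈everything)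
            (λ {x} {y} x∈ y∈ → total (¬adj x y x∈ y∈ ,
               λ { refl → disjoint (x , x∈p∩q⁺ (x∈ , y∈)) }))
            (≤-reflexive (trans (toℕ-fromℕ< b≤n) (sym (+-injective ∣B∣))))
            (≤-reflexive (trans (toℕ-fromℕ< w≤n) (sym (+-injective ∣W∣)))))
          -- Disjoint colors use at most n vertices, so the table after n rounds is final.
          (≤-trans (≤-reflexive (sym (∣∪∣-disjoint B W λ x∈ y∈ → disjoint (_ , x∈p∩q⁺ (x∈ , y∈)))))
                   (∣p∣≤n (B ∪ W)))
      where
      b≤n : b < suc n
      b≤n = s≤s (subst (_≤ n) (+-injective ∣B∣) (∣p∣≤n B))
      w≤n : w < suc n
      w≤n = s≤s (subst (_≤ n) (+-injective ∣W∣) (∣p∣≤n W))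

module _ {n} (G : Graph n) (D : IsPermutationGraph G) where
  open Graph G
  open PermutationGraph G (proj₁ D) (proj₁ (proj₂ D)) (proj₂ (proj₂ D))

  orientation-orients :
    IsTransitiveOrientation (λ u v → ¬ Adj u v × u ≢ v) (orientation G ⟨_,_⟩)
  orientation-orients = transport (λ u v → mk⇔
      (λ (¬g , u≢v) → ¬g ∘ from (matrix-adj G u v) , u≢v)
      (λ (¬a , u≢v) → ¬a ∘ to (matrix-adj G u v) , u≢v))
    (orientation-correct (matrix G)
      (λ {u} {v} → from (matrix-adj G v u) ∘ Adj-sym G ∘ to (matrix-adj G u v))
      (transport (λ u v → mk⇔
          (λ (¬a , u≢v) → ¬a ∘ to (matrix-adj G u v) , u≢v)
          (λ (¬g , u≢v) → ¬g ∘ from (matrix-adj G u v) , u≢v))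
        leftOf-orients))

  orientation-twoDimensional : TwoDimensional (orientation G ⟨_,_⟩) Crosses
  orientation-twoDimensional = twoDimensional (λ u v → T? (adj u v))
    (λ u v → at (orientation G) u v ≟ true) Crosses? (Adj-sym G)
    (λ {u} → subst T (irrefl u)) orientation-orients crosses-orients

integerOf : ℤ → Bool × List Bool
integerOf (+ m)    = false , digitsOf (ℕᵇ.fromℕ m)
integerOf -[1+ m ] = true , digitsOf (ℕᵇ.fromℕ m)

decide-correct : ∀ {n} (G : Graph n) → IsPermutationGraph G → ∀ b w →
  ⟦ decideᵗ ⟧[ n ] ((matrix G , integerOf b , integerOf w) ∷ []) ≡ true
  ⇔ HasBlackAndWhiteColoring G b w
decide-correct G D (+ b)    (+ w)    = coloring-correct G
  (orientation-orients G D) (orientation-twoDimensional G D) b w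
decide-correct G D (+ b)    -[1+ w ] = mk⇔ (λ ()) λ { (_ , _ , _ , _ , () , _) }
decide-correct G D -[1+ b ] w        = mk⇔ (λ ()) λ { (_ , _ , _ , () , _) }

encodeVec-encodeList : ∀ {A : Set} {n} {g : A → Tree} {f : Fin n → A} {h : Fin n → Tree} →
  (∀ i → g (f i) ≡ h i) → encodeVec g (Vec.tabulate f) ≡ encodeList (List.tabulate h)
encodeVec-encodeList {n = zero}  eq = refl
encodeVec-encodeList {n = suc n} eq = cong₂ cons (eq zero) (encodeVec-encodeList (eq ∘ suc))

encodeGraph-matrix : ∀ {n} (G : Graph n) → enc mat (matrix G) ≡ encodeGraph G
encodeGraph-matrix G = encodeVec-encodeList λ u → encodeVec-encodeList λ v → refl

encodeℤ-integerOf : ∀ {n} z → enc integer {n} (integerOf z) ≡ encodeℤ z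
encodeℤ-integerOf {n} (+ m)    = cong (cons nil) (sym (encodeℕᵇ-digits (ℕᵇ.fromℕ m) {n}))
encodeℤ-integerOf {n} -[1+ m ] = cong (cons (cons nil nil)) (sym (encodeℕᵇ-digits (ℕᵇ.fromℕ m) {n}))

-- Walking down the matrix rows in register 2 builds n in unary in register 1, the clock of the
-- compiled code, while the input stays in register 0.
countRows program : Cmd
countRows = while var 2 loop (1 ≔ cons nil (var 1) ⨾ 2 ≔ tl (var 2))
program   = 2 ≔ hd (var 0) ⨾ countRows ⨾ compile decideᵗ (layout λ _ → 0) 2 ⨾ 0 ≔ var 2

-- A row costs 9: 2 for the test, 4 for the increment, 3 for the tail.
Exec-countRows : ∀ ts {m s} → s 1 ≡ unary m → s 2 ≡ encodeList ts →
  Exec countRows s (length ts * 9 + 2) λ s′ → s′ 1 ≡ unary (length ts + m) × s′ 0 ≡ s 0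
Exec-countRows [] eq₁ eq₂ = exec (while-false (cong truth eq₂)) ≤-refl (eq₁ , refl)
Exec-countRows (t ∷ ts) {m} {s} eq₁ eq₂
  with Exec-countRows ts {suc m}
         {(s [ 1 ↦ cons nil (s 1) ]) [ 2 ↦ tail (s 2) ]} (cong (cons nil) eq₁) (cong tail eq₂)
... | exec r t≤ (eq , same) =
  exec (while-true (cong truth eq₂) (seq assign assign) r) (+-monoʳ-≤ 9 t≤)
       (trans eq (cong unary (+-suc (length ts) m)) , same)

length<size : ∀ ts → length ts < size (encodeList ts)
length<size []       = s≤s z≤n
length<size (t ∷ ts) = s≤s (≤-trans (length<size ts) (m≤n+m _ (size t)))

rows : ∀ {n} → Graph n → List Tree
rows G = List.tabulate λ u → encodeList (List.tabulate λ v → encodeBool (Graph.adj G u v))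

length-rows : ∀ {n} (G : Graph n) → length (rows G) ≡ n
length-rows G = length-tabulate λ u →
  encodeList (List.tabulate λ v → encodeBool (Graph.adj G u v))

programTime : ℕ → ℕ
programTime n = 3 + ((n * 9 + 2) + (timeBound decideᵗ n + 2))

programTime-poly : Polynomial programTime
programTime-poly = poly-+ (poly-const 3) (poly-+
  (poly-+ (poly-* (poly-extent card) (poly-const 9)) (poly-const 2))
  (poly-+ (timeBound-poly decideᵗ) (poly-const 2)))

Exec-program : ∀ I → let open Instance I in
  Exec program (initial (encodeInstance I)) (programTime order) λ s →
    s 0 ≡ encodeBool (⟦ decideᵗ ⟧[ order ] ((matrix graph , integerOf b , integerOf w) ∷ []))
Exec-program I =
  Exec-assign {s = s₀}
    {Q = λ s → s 1 ≡ nil × s 2 ≡ encodeList (rows graph) × s 0 ≡ encodeInstance I}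
    ≤-refl (refl , refl , refl) >>= λ (eq₁ , eq₂ , eq₀) →
  Exec-map (≤-reflexive (cong (λ n → n * 9 + 2) (length-rows graph))) id
    (Exec-countRows (rows graph) {0} eq₁ eq₂) >>= λ (eq₁′ , eq₀′) →
  compile-correct decideᵗ {layout λ _ → 0}
    {γ = (matrix graph , integerOf b , integerOf w) ∷ []} record
    { 1<k   = ≤-refl
    ; clock = trans eq₁′ (cong unary (trans (+-identityʳ _) (length-rows graph)))
    ; below = λ { zero → s≤s z≤n }
    ; holds = λ { zero → trans eq₀′ (trans eq₀ (sym input≡)) }
    } >>= λ (eq , _) →
  Exec-assign ≤-refl eq
  where
  open Instance I
  s₀ = initial (encodeInstance I)
  input≡ : enc input (matrix graph , integerOf b , integerOf w) ≡ encodeInstance I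
  input≡ = cong₂ cons (encodeGraph-matrix graph)
    (cong₂ cons (encodeℤ-integerOf {order} b) (encodeℤ-integerOf {order} w))

truth-encodeBool : ∀ p → truth (encodeBool p) ≡ p
truth-encodeBool false = refl
truth-encodeBool true  = refl

-- The matrix alone has size above its number of rows, and the enclosing pair adds one more, which
-- matches the base of `Polynomial`.
order<size : ∀ I → 2 + Instance.order I ≤ size (encodeInstance I)
order<size I = s≤s (≤-trans
  (subst (_< size (encodeGraph graph)) (length-rows graph) (length<size (rows graph)))
  (m≤m+n _ _))
  where open Instance I

theorem1 : DecidableInPolynomialTime encodeInstance HasColoring
theorem1 = let c , d , time≤ = programTime-poly in program , c , d , λ I →
  let open Instance I
      exec {s} {t} run t≤ eq = Exec-program I
  in s , t , run
   , ≤-trans t≤ (≤-trans (time≤ order) (*-monoʳ-≤ c (^-monoˡ-≤ d (order<size I))))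
   , via (trans (cong truth eq) (truth-encodeBool _))
         (decide-correct graph permutationGraph b w)
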